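{- For $n>0$ and $J\subseteq S$, there are bijections $\mathfrak{S}_n^J(231)\simeq \mathrm{NC}_n^J\simeq \mathrm{NN}_n^J$. In particular these three sets have the same cardinality.
   Context: Let $\mathfrak{S}_n$ be the symmetric group on $[n]=\{1,\dots,n\}$, $s_i=(i,i+1)$, $S=\{s_1,\dots,s_{n-1}\}$, permutations written in one-line notation $w=w_1\cdots w_n$. The inversion set is $\mathrm{inv}(w)=\{(i,j):i<j,\ w_i>w_j\}$, and $u\le_S v$ iff $\mathrm{inv}(u)\subseteq\mathrm{inv}(v)$. For $J\subseteq S$, $\mathfrak{S}_n^J=\{w: w<_S ws \text{ for all } s\in J\}$ (concretely: $w_i<w_{i+1}$ whenever $s_i\in J$). Writing $J=S\setminus\{s_{j_1},\dots,s_{j_r}\}$ with $j_1<\dots<j_r$, the $J$-regions are the blocks $\{1,\dots,j_1\},\{j_1+1,\dots,j_2\},\dots,\{j_r+1,\dots,n\}$. An element $w\in\mathfrak{S}_n^J$ is $(J,231)$-avoiding if there are no indices $i<j<k$ in pairwise different $J$-regions with $w_k<w_i<w_j$ and $w_i=w_k+1$; $\mathfrak{S}_n^J(231)$ is the set of such elements. For a set partition $\mathbf P$ of $[n]$, a bump is a pair $(a,b)$, $a<b$, with $a,b$ in the same part and no element $c$ of that part with $a<c<b$. $\mathbf P$ is $J$-noncrossing if: (NC1) no two distinct elements of the same $J$-region lie in the same part; (NC2) whenever two distinct bumps $(i_1,i_2),(j_1,j_2)$ satisfy $i_1<j_1<i_2<j_2$, either $i_1,j_1$ lie in the same $J$-region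 or $i_2,j_1$ lie in the same $J$-region; (NC3) whenever two distinct bumps satisfy $i_1<j_1<j_2<i_2$, then $i_1$ and $j_1$ lie in different $J$-regions. $\mathrm{NC}_n^J$ is the set of $J$-noncrossing partitions. $\mathbf P$ is $J$-nonnesting if (NN1) no two distinct elements of the same $J$-region lie in the same part, and (NN2) there are no two distinct bumps $(i_1,i_2),(j_1,j_2)$ with $i_1<j_1<j_2<i_2$. $\mathrm{NN}_n^J$ is the set of $J$-nonnesting partitions. -}

module Defs where

open import Data.Nat using (ℕ; suc)
open import Data.Fin using (Fin; suc; toℕ; inject₁; _<_; _≤_)
open import Data.Fin.Permutation using (Permutation′; _⟨$⟩ʳ_; _≈_)
open import Data.Fin.Subset using (Subset; Nonempty; _∈_; _∉_)
open import Data.Product using (Σ; ∃; ∃!; _×_; _,_; proj₁)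
open import Data.Sum using (_⊎_)
open import Function.Bundles using (_⇔_; Bijection)
open import Level using (0ℓ) renaming (suc to lsuc)
open import Relation.Binary.Bundles using (Setoid)
import Relation.Binary.Construct.On as On
open import Relation.Binary.PropositionalEquality using (_≡_; _≢_; refl; sym; trans; setoid)
open import Relation.Nullary using (¬_)
open import Relation.Unary using (Pred)
open import Relation.Unary.Relation.Binary.Equality using (≐-setoid)

-- Throughout n = suc m, and [n] is modelled by Fin (suc m), so the element
-- i of [n] is the one with toℕ equal to i - 1.  A subset J of the simple
-- reflections is a Subset m: the index k : Fin m stands for the reflection
-- exchanging the adjacent elements inject₁ k and suc k of Fin (suc m).

-- The J-regions are the intervals into which the reflections outside J cut
-- [n]; the reflection k separates the elements i ≤ k from those with i > k.
SameRegion : ∀ {m} → Subset m → Fin (suc m) → Fin (suc m) → Set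
SameRegion J i j = ∀ k → k ∉ J → (i ≤ k) ⇔ (j ≤ k)

-- Right multiplication by a simple reflection exchanges adjacent positions of
-- the one-line notation, so that w lies below w s exactly when the two entries
-- concerned are increasing.
InParabolicQuotient : ∀ {m} → Subset m → Permutation′ (suc m) → Set
InParabolicQuotient J w = ∀ k → k ∈ J → w ⟨$⟩ʳ inject₁ k < w ⟨$⟩ʳ suc k

Is231Pattern : ∀ {m} → Subset m → Permutation′ (suc m) → (i j k : Fin (suc m)) → Set
Is231Pattern J w i j k =
  i < j × j < k ×
  ¬ SameRegion J i j × ¬ SameRegion J j k × ¬ SameRegion J i k ×
  w ⟨$⟩ʳ k < w ⟨$⟩ʳ i × w ⟨$⟩ʳ i < w ⟨$⟩ʳ j ×
  toℕ (w ⟨$⟩ʳ i) ≡ suc (toℕ (w ⟨$⟩ʳ k))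

Avoids231 : ∀ {m} → Subset m → Permutation′ (suc m) → Set
Avoids231 J w = ∀ i j k → ¬ Is231Pattern J w i j k

record SetPartition (n : ℕ) : Set₁ where
  field
    IsPart   : Pred (Subset n) 0ℓ
    nonempty : ∀ {p} → IsPart p → Nonempty p
    covers   : ∀ i → ∃! _≡_ λ p → IsPart p × i ∈ p

open SetPartition public

SamePart : ∀ {n} → SetPartition n → Fin n → Fin n → Set
SamePart P a b = ∃ λ p → IsPart P p × a ∈ p × b ∈ p

Bump : ∀ {n} → SetPartition n → Fin n → Fin n → Set
Bump P a b = a < b ×
  ∃ λ p → IsPart P p × a ∈ p × b ∈ p × (∀ c → c ∈ p → ¬ (a < c × c < b))

SeparatesRegions : ∀ {m} → Subset m → SetPartition (suc m) → Set
SeparatesRegions J P = ∀ i j → i ≢ j → SameRegion J i j → ¬ SamePart P i j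

record IsNoncrossing {m} (J : Subset m) (P : SetPartition (suc m)) : Set where
  field
    nc₁ : SeparatesRegions J P
    nc₂ : ∀ i₁ i₂ j₁ j₂ → Bump P i₁ i₂ → Bump P j₁ j₂ → (i₁ , i₂) ≢ (j₁ , j₂) →
          i₁ < j₁ → j₁ < i₂ → i₂ < j₂ →
          SameRegion J i₁ j₁ ⊎ SameRegion J i₂ j₁
    nc₃ : ∀ i₁ i₂ j₁ j₂ → Bump P i₁ i₂ → Bump P j₁ j₂ → (i₁ , i₂) ≢ (j₁ , j₂) →
          i₁ < j₁ → j₁ < j₂ → j₂ < i₂ →
          ¬ SameRegion J i₁ j₁

record IsNonnesting {m} (J : Subset m) (P : SetPartition (suc m)) : Set where
  field
    nn₁ : SeparatesRegions J P
    nn₂ : ∀ i₁ i₂ j₁ j₂ → Bump P i₁ i₂ → Bump P j₁ j₂ → (i₁ , i₂) ≢ (j₁ , j₂) →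
          ¬ (i₁ < j₁ × j₁ < j₂ × j₂ < i₂)

-- Permutations are equal when they agree pointwise, set partitions when they
-- have the same parts; the setoids below ignore the membership proofs.

permutationSetoid : ℕ → Setoid 0ℓ 0ℓ
permutationSetoid n = record
  { Carrier       = Permutation′ n
  ; _≈_           = _≈_
  ; isEquivalence = record
    { refl  = λ _ → refl
    ; sym   = λ e i → sym (e i)
    ; trans = λ e f i → trans (e i) (f i)
    }
  }

partitionSetoid : ℕ → Setoid (lsuc 0ℓ) 0ℓ
partitionSetoid n = On.setoid (≐-setoid (Subset n) 0ℓ) (IsPart {n})

𝔖231 : ∀ {m} → Subset m → Setoid 0ℓ 0ℓ
𝔖231 {m} J = On.setoid {B = Σ (Permutation′ (suc m)) λ w → InParabolicQuotient J w × Avoids231 J w}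
                       (permutationSetoid (suc m)) proj₁

NC : ∀ {m} → Subset m → Setoid (lsuc 0ℓ) 0ℓ
NC {m} J = On.setoid {B = Σ (SetPartition (suc m)) (IsNoncrossing J)}
                     (partitionSetoid (suc m)) proj₁

NN : ∀ {m} → Subset m → Setoid (lsuc 0ℓ) 0ℓ
NN {m} J = On.setoid {B = Σ (SetPartition (suc m)) (IsNonnesting J)}
                     (partitionSetoid (suc m)) proj₁

HasCardinality : ∀ {a ℓ} → Setoid a ℓ → ℕ → Set _
HasCardinality S k = Bijection S (setoid (Fin k))

{-# OPTIONS --safe #-}

-- A partition all of whose bumps join different regions is recorded by its sets O and C
-- of left and right ends of bumps.  Only pairs (O , C) satisfying ballot inequalities
-- between the regions occur.  Conversely, for any total order on the positions, closing
-- from left to right and always taking the least available opener turns a ballot pair into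
-- a unique matching.  The usual order yields the nonnesting partitions; the order "later
-- region first, from left to right inside a region" yields the noncrossing ones.
--
-- For a permutation w take the arcs (i , k) with i < k and w i = w k + 1.  If w avoids 231,
-- then reading the positions by increasing value is forced by (O , C): after a closer p
-- comes the first unread position of the last unfinished region left of p, and otherwise
-- the leftmost position that is first unread in its region and not an opener.  The ballot
-- inequalities are what keeps this reading from getting stuck.  So all three sets are
-- encoded by the ballot pairs.

module Submission where

open import Defs
open import Data.Bool using (true; false)
open import Data.Empty using (⊥; ⊥-elim)
open import Data.Fin as Fin using (Fin; zero; suc; toℕ; inject₁; fromℕ<)
import Data.Fin.Properties as Finₚ
open import Data.Fin.Permutation using (Permutation′; permutation; _⟨$⟩ʳ_; _⟨$⟩ˡ_; inverseˡ; inverseʳ)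
open import Data.Fin.Subset using (Subset; inside; outside; _∈_; _∉_; _⊆_; ∣_∣; _-_)
open import Data.Fin.Subset.Properties using (_∈?_; ⊆-antisym; p⊆q⇒∣p∣≤∣q∣; x∈p∧x≢y⇒x∈p-y; x∈p⇒∣p-x∣<∣p∣)
open import Data.List as List using (List; []; _∷_; length; filter; cartesianProduct; cartesianProductWith)
open import Data.List.Membership.Propositional using () renaming (_∈_ to _∈ˡ_; _∉_ to _∉ˡ_)
open import Data.List.Membership.Propositional.Properties
  using (∈-cartesianProduct⁺; ∈-cartesianProductWith⁺; ∈-filter⁺; ∈-filter⁻; ∈-lookup)
import Data.List.Membership.DecPropositional as DecMembership
import Data.List.Relation.Unary.All as All
open import Data.List.Relation.Unary.AllPairs using ([]; _∷_)
open import Data.List.Relation.Unary.Any using (here; there; index)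
open import Data.List.Relation.Unary.Any.Properties using (lookup-index)
open import Data.List.Relation.Unary.Unique.Propositional using (Unique)
open import Data.List.Relation.Unary.Unique.Propositional.Properties
  using (filter⁺; cartesianProduct⁺; cartesianProductWith⁺)
open import Data.Nat as ℕ using (ℕ; zero; suc; z≤n; s≤s)
import Data.Nat.Properties as ℕₚ
open import Data.Nat.Induction using (<-wellFounded)
open import Data.Product using (∃; Σ; _×_; _,_; proj₁; proj₂)
open import Data.Sum using (_⊎_; inj₁; inj₂; [_,_]′)
open import Data.Vec as Vec using ([]; _∷_; here; there)
open import Data.Vec.Properties using (lookup∘tabulate; []=⇒lookup; lookup⇒[]=; ∷-injective)
open import Function using (_∘_; id)
open import Function.Bundles using (Bijection; Equivalence; mk⇔)
open import Function.Construct.Composition using () renaming (bijection to _⤖-∘_)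
open import Function.Construct.Symmetry using (bijection-≡)
open import Induction.WellFounded using (Acc; acc)
import Level
open import Relation.Binary.Bundles using (Setoid)
import Relation.Binary.Construct.On as On
open import Relation.Binary.Definitions using (tri<; tri≈; tri>)
open import Relation.Binary.PropositionalEquality
  using (_≡_; _≢_; refl; sym; trans; cong; cong₂; subst)
open import Relation.Nullary using (¬_; Dec; yes; no; does)
open import Relation.Nullary.Decidable using (_×-dec_; _⊎-dec_; ¬?; _→-dec_; dec-true; map′; decidable-stable)
open import Relation.Unary using (Pred; Decidable)

private variable
  n n′ : ℕ

-- Finite sets

module _ {p} {P : Pred (Fin n) p} (P? : Decidable P) where

  comprehension : Subset n
  comprehension = Vec.tabulate (does ∘ P?)

  ∈-comprehension⁺ : ∀ {x} → P x → x ∈ comprehension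
  ∈-comprehension⁺ {x} px =
    lookup⇒[]= x comprehension (trans (lookup∘tabulate _ x) (dec-true (P? x) px))

  ∈-comprehension⁻ : ∀ {x} → x ∈ comprehension → P x
  ∈-comprehension⁻ {x} x∈ with P? x | trans (sym (lookup∘tabulate (does ∘ P?) x)) ([]=⇒lookup x∈)
  ... | yes px | _ = px

-- Delete from `q` the image found for the first element of `p`; co-functionality of `R` keeps every
-- later element away from it. Asking only for a relation lets an arc relation, or its converse,
-- serve as the injection.
∣∣-injection-≤ : ∀ {r} (p : Subset n) (q : Subset n′) (R : Fin n → Fin n′ → Set r) →
  (∀ {x} → x ∈ p → ∃ λ y → y ∈ q × R x y) →
  (∀ {x x′ y} → R x y → R x′ y → x ≡ x′) →
  ∣ p ∣ ℕ.≤ ∣ q ∣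
∣∣-injection-≤ []            q R f inj = z≤n
∣∣-injection-≤ (outside ∷ p) q R f inj =
  ∣∣-injection-≤ p q (R ∘ suc) (f ∘ there) (λ r r′ → Finₚ.suc-injective (inj r r′))
∣∣-injection-≤ (inside ∷ p)  q R f inj with f here
... | y , y∈q , Ry = ℕₚ.≤-trans (s≤s (∣∣-injection-≤ p (q - y) (R ∘ suc) g (λ r r′ → Finₚ.suc-injective (inj r r′))))
                               (x∈p⇒∣p-x∣<∣p∣ y∈q)
  where
  g : ∀ {x} → x ∈ p → ∃ λ z → z ∈ q - y × R (suc x) z
  g x∈p with f (there x∈p)
  ... | z , z∈q , Rz = z , x∈p∧x≢y⇒x∈p-y z∈q (λ { refl → Finₚ.0≢1+n (inj Ry Rz) }) , Rz

∣∣-injection-< : ∀ {r} (p : Subset n) (q : Subset n′) (R : Fin n → Fin n′ → Set r) z →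
  (∀ {x} → x ∈ p → ∃ λ y → y ∈ q × R x y × y ≢ z) →
  (∀ {x x′ y} → R x y → R x′ y → x ≡ x′) →
  z ∈ q → ∣ p ∣ ℕ.< ∣ q ∣
∣∣-injection-< p q R z f inj z∈q =
  ℕₚ.≤-<-trans (∣∣-injection-≤ p (q - z) R g inj) (x∈p⇒∣p-x∣<∣p∣ z∈q)
  where
  g : ∀ {x} → x ∈ p → ∃ λ y → y ∈ q - z × R x y
  g x∈p with f x∈p
  ... | y , y∈q , Ry , y≢z = y , x∈p∧x≢y⇒x∈p-y y∈q y≢z , Ry

least : ∀ {p r} {P : Pred (Fin n) p} (P? : Decidable P) (_≼_ : Fin n → Fin n → Set r) →
  (∀ x y → x ≼ y ⊎ y ≼ x) → (∀ {x y z} → x ≼ y → y ≼ z → x ≼ z) →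
  (∀ x → ¬ P x) ⊎ ∃ λ x → P x × (∀ y → P y → x ≼ y)
least {zero}  P? _≼_ total tr = inj₁ λ ()
least {suc n} P? _≼_ total tr
  with P? zero | least (P? ∘ suc) (λ x y → suc x ≼ suc y) (λ x y → total (suc x) (suc y)) tr
... | no ¬p0 | inj₁ ¬ps = inj₁ λ { zero → ¬p0 ; (suc x) → ¬ps x }
... | no ¬p0 | inj₂ (x , px , x≼) =
  inj₂ (suc x , px , λ { zero p0 → ⊥-elim (¬p0 p0) ; (suc y) → x≼ y })
... | yes p0 | inj₁ ¬ps =
  inj₂ (zero , p0 , λ { zero _ → [ id , id ]′ (total zero zero) ; (suc y) py → ⊥-elim (¬ps y py) })
... | yes p0 | inj₂ (x , px , x≼) with total zero (suc x)
...   | inj₁ 0≼ = inj₂ (zero , p0 , λ { zero _ → [ id , id ]′ (total zero zero) ; (suc y) py → tr 0≼ (x≼ y py) })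
...   | inj₂ ≼0 = inj₂ (suc x , px , λ { zero _ → ≼0 ; (suc y) → x≼ y })

-- By the pigeonhole principle: a missed `y` would make the full set strictly smaller than itself.
injection⇒permutation : (f : Fin n → Fin n) → (∀ {x y} → f x ≡ f y → x ≡ y) →
  Σ (Permutation′ n) λ w → ∀ x → w ⟨$⟩ʳ x ≡ f x
injection⇒permutation {n} f inj = permutation f f⁻¹ right (λ x → inj (right (f x))) , λ _ → refl
  where
  surjective : ∀ y → ∃ λ x → f x ≡ y
  surjective y with Finₚ.any? (λ x → f x Finₚ.≟ y)
  ... | yes hit  = hit
  ... | no ¬hit = ⊥-elim (ℕₚ.<-irrefl refl
          (∣∣-injection-< all all (λ x z → f x ≡ z) y
            (λ {x} _ → f x , everything , refl , λ eq → ¬hit (x , eq))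
            (λ e e′ → inj (trans e (sym e′))) everything))
    where
    all : Subset n
    all = comprehension (λ (x : Fin n) → x Finₚ.≟ x)
    everything : ∀ {x} → x ∈ all
    everything = ∈-comprehension⁺ (λ x → x Finₚ.≟ x) refl
  f⁻¹ : Fin n → Fin n
  f⁻¹ y = proj₁ (surjective y)
  right : ∀ y → f (f⁻¹ y) ≡ y
  right y = proj₂ (surjective y)

lookup-injective : ∀ {a} {A : Set a} {xs : List A} → Unique xs →
  ∀ i j → List.lookup xs i ≡ List.lookup xs j → i ≡ j
lookup-injective (_ ∷ _)  zero    zero    eq = refl
lookup-injective (px ∷ _) zero    (suc j) eq = ⊥-elim (All.lookup px (∈-lookup j) eq)
lookup-injective (px ∷ _) (suc i) zero    eq = ⊥-elim (All.lookup px (∈-lookup i) (sym eq))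
lookup-injective (_ ∷ u)  (suc i) (suc j) eq = cong suc (lookup-injective u i j eq)

subsets : ∀ n → List (Subset n)
subsets zero    = [] ∷ []
subsets (suc n) = cartesianProductWith _∷_ (true ∷ false ∷ []) (subsets n)

subsets-unique : ∀ n → Unique (subsets n)
subsets-unique zero    = All.[] ∷ []
subsets-unique (suc n) = cartesianProductWith⁺ _∷_ ∷-injective
  (((λ ()) All.∷ All.[]) ∷ (All.[] ∷ [])) (subsets-unique n)

∈-subsets : (p : Subset n) → p ∈ˡ subsets n
∈-subsets []      = here refl
∈-subsets (b ∷ p) = ∈-cartesianProductWith⁺ _∷_ (bool b) (∈-subsets p)
  where
  bool : ∀ b → b ∈ˡ (true ∷ false ∷ [])
  bool true  = here refl
  bool false = there (here refl)

-- Encodings by pairs of subsets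

Code : ℕ → Set
Code n = Subset n × Subset n

record IsEncoding {a ℓ q} (S : Setoid a ℓ) (Valid : Pred (Code n) q)
                  (encode : Setoid.Carrier S → Code n) : Set (a Level.⊔ ℓ Level.⊔ q) where
  open Setoid S using (Carrier; _≈_)
  field
    congruent  : ∀ {x y} → x ≈ y → encode x ≡ encode y
    injective  : ∀ {x y} → encode x ≡ encode y → x ≈ y
    valid      : ∀ x → Valid (encode x)
    surjective : ∀ c → Valid c → ∃ λ x → encode x ≡ c

module _ {q} {Valid : Pred (Code n) q} (valid? : Decidable Valid) where

  validCodes : List (Code n)
  validCodes = filter valid? (cartesianProduct (subsets n) (subsets n))

  -- Each element is numbered by the place of its code in the duplicate-free list of valid codes.
  -- That list depends on `Valid` alone, so all setoids encoded by the same codes get the same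
  -- cardinality.
  encoding⇒cardinality : ∀ {a ℓ} {S : Setoid a ℓ} {encode} → IsEncoding S Valid encode →
    HasCardinality S (length validCodes)
  encoding⇒cardinality {S = S} {encode} E = record
    { to        = number
    ; cong      = λ {x} {y} x≈y → number-≡ (congruent x≈y)
    ; bijective = (λ {x} {y} eq → injective (trans (encode≡lookup x) (trans (cong (List.lookup validCodes) eq) (sym (encode≡lookup y)))))
                , λ i → let x , eq = surjective _ (proj₂ (∈-filter⁻ valid? {xs = cartesianProduct (subsets n) (subsets n)} (∈-lookup i)))
                        in x , λ {z} z≈x → unique (number z) i (trans (sym (encode≡lookup z)) (trans (congruent z≈x) eq))
    }
    where
    open Setoid S using (Carrier; _≈_)
    open IsEncoding E
    listed : ∀ x → encode x ∈ˡ validCodes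
    listed x = ∈-filter⁺ valid? (∈-cartesianProduct⁺ (∈-subsets _) (∈-subsets _)) (valid x)
    number : Carrier → Fin (length validCodes)
    number x = index (listed x)
    encode≡lookup : ∀ x → encode x ≡ List.lookup validCodes (number x)
    encode≡lookup x = lookup-index (listed x)
    unique : ∀ i j → List.lookup validCodes i ≡ List.lookup validCodes j → i ≡ j
    unique = lookup-injective (filter⁺ valid? (cartesianProduct⁺ (subsets-unique n) (subsets-unique n)))
    -- The index is computed from a membership proof, so equal codes give equal numbers only because
    -- the list has no repetitions.
    number-≡ : ∀ {x y} → encode x ≡ encode y → number x ≡ number y
    number-≡ {x} {y} eq = unique _ _ (trans (sym (encode≡lookup x)) (trans eq (encode≡lookup y)))

-- Matchings

Arcs : ℕ → Set₁
Arcs n = Fin n → Fin n → Set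

module _ {A : Arcs n} (A? : ∀ i k → Dec (A i k)) where

  opens? : Decidable λ i → ∃ λ k → A i k
  opens? i = Finₚ.any? (A? i)

  closes? : Decidable λ k → ∃ λ i → A i k
  closes? k = Finₚ.any? (λ i → A? i k)

  openers closers : Subset n
  openers = comprehension opens?
  closers = comprehension closes?

module Matchings (reg : Fin n → ℕ) (reg-mono : ∀ {i j} → i Fin.≤ j → reg i ℕ.≤ reg j) where

  -- `O` and `C` may overlap: an inner element of a part ends one bump and starts the next.
  record IsMatching (O C : Subset n) (A : Arcs n) : Set where
    field
      opener       : ∀ {i k} → A i k → i ∈ O
      closer       : ∀ {i k} → A i k → k ∈ C
      outgoing     : ∀ {i} → i ∈ O → ∃ λ k → A i k
      incoming     : ∀ {k} → k ∈ C → ∃ λ i → A i k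
      right-unique : ∀ {i k l} → A i k → A i l → k ≡ l
      left-unique  : ∀ {i j k} → A i k → A j k → i ≡ j
      ascending    : ∀ {i k} → A i k → reg i ℕ.< reg k

  matching-map : ∀ {O C A B} → IsMatching O C A → (∀ {i k} → B i k → A i k) → (∀ {i k} → A i k → B i k) →
    IsMatching O C B
  matching-map M f g = record
    { opener       = opener ∘ f
    ; closer       = closer ∘ f
    ; outgoing     = λ i∈O → let k , a = outgoing i∈O in k , g a
    ; incoming     = λ k∈C → let i , a = incoming k∈C in i , g a
    ; right-unique = λ a b → right-unique (f a) (f b)
    ; left-unique  = λ a b → left-unique (f a) (f b)
    ; ascending    = ascending ∘ f
    }
    where open IsMatching M

  openers×closers-matching : {A : Arcs n} (A? : ∀ i k → Dec (A i k)) →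
    (∀ {i k l} → A i k → A i l → k ≡ l) → (∀ {i j k} → A i k → A j k → i ≡ j) →
    (∀ {i k} → A i k → reg i ℕ.< reg k) →
    IsMatching (openers A?) (closers A?) A
  openers×closers-matching A? ru lu asc = record
    { opener       = λ a → ∈-comprehension⁺ (opens? A?) (_ , a)
    ; closer       = λ a → ∈-comprehension⁺ (closes? A?) (_ , a)
    ; outgoing     = ∈-comprehension⁻ (opens? A?)
    ; incoming     = ∈-comprehension⁻ (closes? A?)
    ; right-unique = ru
    ; left-unique  = lu
    ; ascending    = asc
    }

  matching-code : ∀ {O C} {A : Arcs n} (A? : ∀ i k → Dec (A i k)) → IsMatching O C A →
    (openers A? , closers A?) ≡ (O , C)
  matching-code A? M = cong₂ _,_
    (⊆-antisym (λ x∈ → opener (proj₂ (∈-comprehension⁻ (opens? A?) x∈))) (∈-comprehension⁺ (opens? A?) ∘ outgoing))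
    (⊆-antisym (λ x∈ → closer (proj₂ (∈-comprehension⁻ (closes? A?) x∈))) (∈-comprehension⁺ (closes? A?) ∘ incoming))
    where open IsMatching M

  module _ (S : Subset n) (x : Fin n) where

    in≤? : Decidable λ y → y ∈ S × reg y ℕ.≤ reg x
    in≤? y = y ∈? S ×-dec reg y ℕ.≤? reg x
    in<? : Decidable λ y → y ∈ S × reg y ℕ.< reg x
    in<? y = y ∈? S ×-dec reg y ℕ.<? reg x
    in≥? : Decidable λ y → y ∈ S × reg x ℕ.≤ reg y
    in≥? y = y ∈? S ×-dec reg x ℕ.≤? reg y
    in>? : Decidable λ y → y ∈ S × reg x ℕ.< reg y
    in>? y = y ∈? S ×-dec reg x ℕ.<? reg y

  infix 5 _≤ᵣ_ _<ᵣ_ _≥ᵣ_ _>ᵣ_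

  _≤ᵣ_ _<ᵣ_ _≥ᵣ_ _>ᵣ_ : Subset n → Fin n → Subset n
  S ≤ᵣ x = comprehension (in≤? S x)
  S <ᵣ x = comprehension (in<? S x)
  S ≥ᵣ x = comprehension (in≥? S x)
  S >ᵣ x = comprehension (in>? S x)

  -- The first inequality keeps a closer from being left without an opener, the second keeps the
  -- reading of a word from halting after a non-closer, and the third leaves no opener unmatched at
  -- the end.
  Ballot : Code n → Set
  Ballot (O , C) =
    (∀ x → ∣ C ≤ᵣ x ∣ ℕ.≤ ∣ O <ᵣ x ∣) ×
    (∀ x → ∣ O ≥ᵣ x ∣ ℕ.≤ ∣ C >ᵣ x ∣) ×
    ∣ O ∣ ℕ.≤ ∣ C ∣

  ballot? : Decidable Ballot
  ballot? (O , C) =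
    Finₚ.all? (λ x → ∣ C ≤ᵣ x ∣ ℕ.≤? ∣ O <ᵣ x ∣) ×-dec
    Finₚ.all? (λ x → ∣ O ≥ᵣ x ∣ ℕ.≤? ∣ C >ᵣ x ∣) ×-dec
    (∣ O ∣ ℕ.≤? ∣ C ∣)

  -- Each inequality is an injection along the arcs, which strictly raise the region.
  matching⇒ballot : ∀ {O C A} → IsMatching O C A → Ballot (O , C)
  matching⇒ballot {O} {C} {A} M =
      (λ x → ∣∣-injection-≤ (C ≤ᵣ x) (O <ᵣ x) (λ k i → A i k)
        (λ k∈ → let k∈C , k≤x = ∈-comprehension⁻ (in≤? C x) k∈
                    i , a     = incoming k∈C
                in i , ∈-comprehension⁺ (in<? O x) (opener a , ℕₚ.<-≤-trans (ascending a) k≤x) , a)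
        right-unique)
    , (λ x → ∣∣-injection-≤ (O ≥ᵣ x) (C >ᵣ x) A
        (λ i∈ → let i∈O , x≤i = ∈-comprehension⁻ (in≥? O x) i∈
                    k , a     = outgoing i∈O
                in k , ∈-comprehension⁺ (in>? C x) (closer a , ℕₚ.≤-<-trans x≤i (ascending a)) , a)
        left-unique)
    , ∣∣-injection-≤ O C A (λ i∈O → let k , a = outgoing i∈O in k , closer a , a) left-unique
    where open IsMatching M

  -- Greedy matchings for an arbitrary total order

  module Greedy {r} (_≼_ : Fin n → Fin n → Set r)
    (≼-total : ∀ i j → i ≼ j ⊎ j ≼ i)
    (≼-trans : ∀ {i j k} → i ≼ j → j ≼ k → i ≼ k)
    (≼-antisym : ∀ {i j} → i ≼ j → j ≼ i → i ≡ j) where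

    -- Closing from left to right, every closer takes the ≼-least opener available to it.
    IsGreedy : Arcs n → Set r
    IsGreedy A = ∀ {i j k l} → A i k → A j l → k Fin.< l → reg j ℕ.< reg k → i ≼ j

    -- Induction on the closer `k`. If `A` gives it `i` and `B` gives it `j`, look at the partner of
    -- `i` in `B` and that of `j` in `A`. Neither can lie before `k`, where the matchings agree. If
    -- both lie after `k`, then each of `i` and `j` was available when the other was chosen, and
    -- antisymmetry gives `i ≡ j`.
    greedy-unique : ∀ {O C A B} → IsMatching O C A → IsGreedy A → IsMatching O C B → IsGreedy B →
      ∀ {i k} → A i k → B i k
    greedy-unique {O} {C} {A} {B} M gA N gB {k = k} a = proj₁ (go (<-wellFounded (toℕ k))) a
      where
      module M = IsMatching M
      module N = IsMatching N
      go : ∀ {k} → Acc ℕ._<_ (toℕ k) → ∀ {i} → (A i k → B i k) × (B i k → A i k)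
      go {k} (acc rec) = (λ a → subst (λ x → B x k) (sym (same a (proj₂ (N.incoming (M.closer a))))) (proj₂ (N.incoming (M.closer a))))
                       , (λ b → subst (λ x → A x k) (same (proj₂ (M.incoming (N.closer b))) b) (proj₂ (M.incoming (N.closer b))))
        where
        same : ∀ {i j} → A i k → B j k → i ≡ j
        same {i} {j} a b with N.outgoing (M.opener a) | M.outgoing (N.opener b)
        ... | l , b′ | l′ , a′ with Finₚ.<-cmp l k | Finₚ.<-cmp l′ k
        ... | tri≈ _ refl _ | _ = N.left-unique b′ b
        ... | _ | tri≈ _ refl _ = M.left-unique a a′
        ... | tri< l<k l≢k _ | _ = ⊥-elim (l≢k (M.right-unique (proj₂ (go (rec l<k)) b′) a))
        ... | _ | tri< l′<k l′≢k _ = ⊥-elim (l′≢k (N.right-unique (proj₁ (go (rec l′<k)) a′) b))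
        ... | tri> _ _ k<l | tri> _ _ k<l′ =
          ≼-antisym (gA a a′ k<l′ (N.ascending b)) (gB b b′ k<l (M.ascending a))

    module _ {O C : Subset n} (ballot : Ballot (O , C)) where

      -- The invariant of the construction once the closers before `t` are served. Openers may still
      -- lack a partner, so `greedy` compares `i` with every opener not yet closed by `k` rather
      -- than with openers of later arcs.
      record GreedyUpTo (t : ℕ) : Set (Level.suc Level.zero Level.⊔ r) where
        field
          A            : Arcs n
          A?           : ∀ i k → Dec (A i k)
          opener       : ∀ {i k} → A i k → i ∈ O
          closer       : ∀ {i k} → A i k → k ∈ C
          early        : ∀ {i k} → A i k → toℕ k ℕ.< t
          incoming     : ∀ {k} → k ∈ C → toℕ k ℕ.< t → ∃ λ i → A i k
          right-unique : ∀ {i k l} → A i k → A i l → k ≡ l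
          left-unique  : ∀ {i j k} → A i k → A j k → i ≡ j
          ascending    : ∀ {i k} → A i k → reg i ℕ.< reg k
          greedy       : ∀ {i j k} → A i k → j ∈ O → reg j ℕ.< reg k →
                         (∃ λ l → A j l × l Fin.≤ k) ⊎ i ≼ j

      module Extend {t} (G : GreedyUpTo t) (k : Fin n) (k≡t : toℕ k ≡ t) where
        open GreedyUpTo G

        skip : k ∉ C → GreedyUpTo (suc t)
        skip k∉C = record
          { A = A ; A? = A? ; opener = opener ; closer = closer ; early = ℕₚ.m<n⇒m<1+n ∘ early
          ; incoming = incoming′ ; right-unique = right-unique ; left-unique = left-unique
          ; ascending = ascending ; greedy = greedy }
          where
          incoming′ : ∀ {l} → l ∈ C → toℕ l ℕ.< suc t → ∃ λ i → A i l
          incoming′ {l} l∈C (s≤s l≤t) with ℕₚ.m≤n⇒m<n∨m≡n l≤t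
          ... | inj₁ l<t = incoming l∈C l<t
          ... | inj₂ l≡t = ⊥-elim (k∉C (subst (_∈ C) (Finₚ.toℕ-injective (trans l≡t (sym k≡t))) l∈C))

        Available : Fin n → Set
        Available j = j ∈ O × reg j ℕ.< reg k × ¬ ∃ λ l → A j l

        available? : Decidable Available
        available? j = j ∈? O ×-dec reg j ℕ.<? reg k ×-dec ¬? (Finₚ.any? (A? j))

        before : ∀ {i l} → A i l → l Fin.< k
        before a = subst (_ ℕ.<_) (sym k≡t) (early a)

        -- Otherwise all openers in earlier regions are already matched to closers before `k`. This
        -- injects `O <ᵣ k` into `C ≤ᵣ k` and misses `k`, against the first ballot inequality.
        some-available : k ∈ C → ¬ (∀ j → ¬ Available j)
        some-available k∈C none = ℕₚ.<-irrefl refl (ℕₚ.<-≤-trans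
          (∣∣-injection-< (O <ᵣ k) (C ≤ᵣ k) A k used left-unique
            (∈-comprehension⁺ (in≤? C k) (k∈C , ℕₚ.≤-refl)))
          (proj₁ ballot k))
          where
          used : ∀ {j} → j ∈ O <ᵣ k → ∃ λ l → l ∈ C ≤ᵣ k × A j l × l ≢ k
          used {j} j∈ with Finₚ.any? (A? j) | ∈-comprehension⁻ (in<? O k) j∈
          ... | no ¬a | j∈O , j<k = ⊥-elim (none j (j∈O , j<k , ¬a))
          ... | yes (l , a) | _ =
            l , ∈-comprehension⁺ (in≤? C k) (closer a , reg-mono (ℕₚ.<⇒≤ (before a))) , a , Finₚ.<⇒≢ (before a)

        close : k ∈ C → GreedyUpTo (suc t)
        close k∈C with least available? _≼_ ≼-total ≼-trans
        ... | inj₁ none = ⊥-elim (some-available k∈C none)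
        ... | inj₂ (x , (x∈O , x<k , x-free) , x≼) = record
          { A = λ i l → A i l ⊎ (i ≡ x × l ≡ k)
          ; A? = λ i l → A? i l ⊎-dec (i Finₚ.≟ x ×-dec l Finₚ.≟ k)
          ; opener = λ { (inj₁ a) → opener a ; (inj₂ (refl , refl)) → x∈O }
          ; closer = λ { (inj₁ a) → closer a ; (inj₂ (refl , refl)) → k∈C }
          ; early = λ { (inj₁ a) → ℕₚ.m<n⇒m<1+n (early a) ; (inj₂ (refl , refl)) → s≤s (ℕₚ.≤-reflexive k≡t) }
          ; incoming = incoming′
          ; right-unique = λ { (inj₁ a) (inj₁ b) → right-unique a b
                             ; (inj₁ a) (inj₂ (refl , refl)) → ⊥-elim (x-free (_ , a))
                             ; (inj₂ (refl , refl)) (inj₁ b) → ⊥-elim (x-free (_ , b))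
                             ; (inj₂ (refl , refl)) (inj₂ (refl , refl)) → refl }
          ; left-unique = λ { (inj₁ a) (inj₁ b) → left-unique a b
                            ; (inj₁ a) (inj₂ (refl , refl)) → ⊥-elim (ℕₚ.<-irrefl refl (before a))
                            ; (inj₂ (refl , refl)) (inj₁ b) → ⊥-elim (ℕₚ.<-irrefl refl (before b))
                            ; (inj₂ (refl , refl)) (inj₂ (refl , refl)) → refl }
          ; ascending = λ { (inj₁ a) → ascending a ; (inj₂ (refl , refl)) → x<k }
          ; greedy = greedy′
          }
          where
          incoming′ : ∀ {l} → l ∈ C → toℕ l ℕ.< suc t → ∃ λ i → A i l ⊎ (i ≡ x × l ≡ k)
          incoming′ {l} l∈C (s≤s l≤t) with ℕₚ.m≤n⇒m<n∨m≡n l≤t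
          ... | inj₁ l<t = let i , a = incoming l∈C l<t in i , inj₁ a
          ... | inj₂ l≡t = x , inj₂ (refl , Finₚ.toℕ-injective (trans l≡t (sym k≡t)))
          greedy′ : ∀ {i j l} → A i l ⊎ (i ≡ x × l ≡ k) → j ∈ O → reg j ℕ.< reg l →
                    (∃ λ l′ → (A j l′ ⊎ (j ≡ x × l′ ≡ k)) × l′ Fin.≤ l) ⊎ i ≼ j
          greedy′ (inj₁ a) j∈O j<l with greedy a j∈O j<l
          ... | inj₁ (l′ , b , l′≤l) = inj₁ (l′ , inj₁ b , l′≤l)
          ... | inj₂ i≼j = inj₂ i≼j
          greedy′ {j = j} (inj₂ (refl , refl)) j∈O j<k with Finₚ.any? (A? j)
          ... | yes (l′ , b) = inj₁ (l′ , inj₁ b , ℕₚ.<⇒≤ (before b))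
          ... | no ¬b = inj₂ (x≼ j (j∈O , j<k , ¬b))

      greedyUpTo : ∀ t → t ℕ.≤ n → GreedyUpTo t
      greedyUpTo zero _ = record
        { A = λ _ _ → ⊥ ; A? = λ _ _ → no id ; opener = λ () ; closer = λ () ; early = λ ()
        ; incoming = λ _ () ; right-unique = λ () ; left-unique = λ () ; ascending = λ () ; greedy = λ () }
      greedyUpTo (suc t) t<n with fromℕ< t<n ∈? C
      ... | yes k∈C = Extend.close (greedyUpTo t (ℕₚ.<⇒≤ t<n)) _ (Finₚ.toℕ-fromℕ< t<n) k∈C
      ... | no k∉C  = Extend.skip (greedyUpTo t (ℕₚ.<⇒≤ t<n)) _ (Finₚ.toℕ-fromℕ< t<n) k∉C

      greedy-exists : ∃ λ (A : Arcs n) → (∀ i k → Dec (A i k)) × IsMatching O C A × IsGreedy A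
      greedy-exists = A , A? , record
        { opener = opener ; closer = closer ; outgoing = outgoing
        ; incoming = λ {k} k∈C → incoming k∈C (Finₚ.toℕ<n k)
        ; right-unique = right-unique ; left-unique = left-unique ; ascending = ascending } , isGreedy
        where
        open GreedyUpTo (greedyUpTo n ℕₚ.≤-refl)
        outgoing : ∀ {i} → i ∈ O → ∃ λ k → A i k
        outgoing {i} i∈O with Finₚ.any? (A? i)
        ... | yes a = a
        -- All closers are served, so an opener `i` left over would make `C` strictly smaller than
        -- `O`, against the third inequality.
        ... | no ¬a = ⊥-elim (ℕₚ.<-irrefl refl (ℕₚ.<-≤-trans
          (∣∣-injection-< C O (λ k j → A j k) i
            (λ {k} k∈C → let j , a = incoming k∈C (Finₚ.toℕ<n k) in j , opener a , a , λ { refl → ¬a (_ , a) })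
            right-unique i∈O)
          (proj₂ (proj₂ ballot))))
        isGreedy : IsGreedy A
        isGreedy a b k<l j<k with greedy a (opener b) j<k
        ... | inj₂ i≼j = i≼j
        ... | inj₁ (l′ , b′ , l′≤k) = ⊥-elim (ℕₚ.<⇒≱ k<l (subst (Fin._≤ _) (right-unique b′ b) l′≤k))

-- Set partitions and their bumps

module _ (P : SetPartition n) where

  part : Fin n → Subset n
  part i = proj₁ (covers P i)

  part-isPart : ∀ i → IsPart P (part i)
  part-isPart i = proj₁ (proj₁ (proj₂ (covers P i)))

  ∈-part : ∀ i → i ∈ part i
  ∈-part i = proj₂ (proj₁ (proj₂ (covers P i)))

  part-unique : ∀ {i p} → IsPart P p → i ∈ p → part i ≡ p
  part-unique {i} isPart i∈p = proj₂ (proj₂ (covers P i)) (isPart , i∈p)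

  samePart⇒∈-part : ∀ {a b} → SamePart P a b → b ∈ part a
  samePart⇒∈-part (p , isPart , a∈p , b∈p) = subst (_ ∈_) (sym (part-unique isPart a∈p)) b∈p

  ∈-part⇒samePart : ∀ {a b} → b ∈ part a → SamePart P a b
  ∈-part⇒samePart {a} b∈ = part a , part-isPart a , ∈-part a , b∈

  samePart-trans : ∀ {a b c} → SamePart P a b → SamePart P b c → SamePart P a c
  samePart-trans (p , isPart , a∈p , b∈p) (q , isPart′ , b∈q , c∈q)
    with trans (sym (part-unique isPart b∈p)) (part-unique isPart′ b∈q)
  ... | refl = p , isPart , a∈p , c∈q

  samePart-sym : ∀ {a b} → SamePart P a b → SamePart P b a
  samePart-sym (p , isPart , a∈p , b∈p) = p , isPart , b∈p , a∈p

  bump⇒samePart : ∀ {a b} → Bump P a b → SamePart P a b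
  bump⇒samePart (_ , p , isPart , a∈p , b∈p , _) = p , isPart , a∈p , b∈p

  bump-gap : ∀ {a b c} → Bump P a b → SamePart P a c → ¬ (a Fin.< c × c Fin.< b)
  bump-gap (_ , p , isPart , a∈p , _ , gap) ac =
    gap _ (subst (_ ∈_) (part-unique isPart a∈p) (samePart⇒∈-part ac))

  mkBump : ∀ {a b} → a Fin.< b → SamePart P a b →
    (∀ c → SamePart P a c → ¬ (a Fin.< c × c Fin.< b)) → Bump P a b
  mkBump a<b ab@(p , isPart , a∈p , b∈p) gap =
    a<b , p , isPart , a∈p , b∈p , λ c c∈p → gap c (p , isPart , a∈p , c∈p)

  samePart? : ∀ a b → Dec (SamePart P a b)
  samePart? a b = map′ ∈-part⇒samePart samePart⇒∈-part (b ∈? part a)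

  bump? : ∀ a b → Dec (Bump P a b)
  bump? a b = map′ (λ (a<b , ab , gap) → mkBump a<b ab gap)
                   (λ bump → proj₁ bump , bump⇒samePart bump , λ c → bump-gap bump)
    (a Finₚ.<? b ×-dec samePart? a b ×-dec
     Finₚ.all? (λ c → samePart? a c →-dec ¬? (a Finₚ.<? c ×-dec c Finₚ.<? b)))

  bump-right-unique : ∀ {a b c} → Bump P a b → Bump P a c → b ≡ c
  bump-right-unique {a} {b} {c} ab ac with Finₚ.<-cmp b c
  ... | tri≈ _ b≡c _ = b≡c
  ... | tri< b<c _ _ = ⊥-elim (bump-gap ac (bump⇒samePart ab) (proj₁ ab , b<c))
  ... | tri> _ _ c<b = ⊥-elim (bump-gap ab (bump⇒samePart ac) (proj₁ ac , c<b))

  bump-left-unique : ∀ {a b c} → Bump P a c → Bump P b c → a ≡ b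
  bump-left-unique {a} {b} {c} ac bc with Finₚ.<-cmp a b
  ... | tri≈ _ a≡b _ = a≡b
  ... | tri< a<b _ _ = ⊥-elim (bump-gap ac
          (samePart-trans (bump⇒samePart ac) (samePart-sym (bump⇒samePart bc))) (a<b , proj₁ bc))
  ... | tri> _ _ b<a = ⊥-elim (bump-gap bc
          (samePart-trans (bump⇒samePart bc) (samePart-sym (bump⇒samePart ac))) (b<a , proj₁ ac))

-- Parts as chains of bumps

infixl 5 _▷_

data Path (A : Arcs n) (a : Fin n) : Fin n → Set where
  []  : Path A a a
  _▷_ : ∀ {b c} → Path A a b → A b c → Path A a c

-- The last bump starts at the greatest element of the part below `b`; induction reaches that
-- element from `a`.
samePart⇒path : (P : SetPartition n) → ∀ {a b} → SamePart P a b → a Fin.≤ b → Path (Bump P) a b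
samePart⇒path {n} P {a} {b} = go (<-wellFounded (toℕ b))
  where
  go : ∀ {b} → Acc ℕ._<_ (toℕ b) → SamePart P a b → a Fin.≤ b → Path (Bump P) a b
  go {b} (acc rec) ab a≤b with a Finₚ.≟ b
  ... | yes refl = []
  -- The order is reversed, so `least` returns the greatest candidate.
  ... | no a≢b with least (λ c → samePart? P a c ×-dec c Finₚ.<? b) (λ x y → y Fin.≤ x)
                      (λ x y → ℕₚ.≤-total (toℕ y) (toℕ x)) (λ p q → ℕₚ.≤-trans q p)
  ...   | inj₁ none = ⊥-elim (none a (∈-part⇒samePart P (∈-part P a) , Finₚ.≤∧≢⇒< a≤b a≢b))
  ...   | inj₂ (c , (ac , c<b) , greatest) =
    go (rec c<b) ac (greatest a (∈-part⇒samePart P (∈-part P a) , Finₚ.≤∧≢⇒< a≤b a≢b))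
      ▷ mkBump P c<b (samePart-trans P (samePart-sym P ac) ab)
          (λ d cd (c<d , d<b) → ℕₚ.<⇒≱ c<d (greatest d (samePart-trans P ac cd , d<b)))

path⇒samePart : (P : SetPartition n) → ∀ {a b} → Path (Bump P) a b → SamePart P a b
path⇒samePart P {a} []       = ∈-part⇒samePart P (∈-part P a)
path⇒samePart P     (π ▷ bc) = samePart-trans P (path⇒samePart P π) (bump⇒samePart P bc)

map-path : {A B : Arcs n} → (∀ {i k} → A i k → B i k) → ∀ {a b} → Path A a b → Path B a b
map-path f []      = []
map-path f (π ▷ a) = map-path f π ▷ f a

module _ (P Q : SetPartition n) where

  samePart-mono : (∀ {a b} → Bump P a b → Bump Q a b) → ∀ {a b} → SamePart P a b → SamePart Q a b
  samePart-mono f {a} {b} ab with Finₚ.≤-total a b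
  ... | inj₁ a≤b = path⇒samePart Q (map-path f (samePart⇒path P ab a≤b))
  ... | inj₂ b≤a = samePart-sym Q (path⇒samePart Q (map-path f (samePart⇒path P (samePart-sym P ab) b≤a)))

  -- A part is nonempty, hence it is the class of any of its elements under `SamePart`; equal
  -- relations have equal classes.
  isPart-mono : (∀ {a b} → SamePart P a b → SamePart Q a b) → (∀ {a b} → SamePart Q a b → SamePart P a b) →
    ∀ {p} → IsPart P p → IsPart Q p
  isPart-mono f g {p} isPart with nonempty P isPart
  ... | a , a∈p = subst (IsPart Q) (⊆-antisym Qa⊆p p⊆Qa) (part-isPart Q a)
    where
    Qa⊆p : part Q a ⊆ p
    Qa⊆p b∈ = subst (_ ∈_) (part-unique P isPart a∈p)
                (samePart⇒∈-part P (g (∈-part⇒samePart Q b∈)))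
    p⊆Qa : p ⊆ part Q a
    p⊆Qa b∈p = samePart⇒∈-part Q (f (p , isPart , a∈p , b∈p))

bumps-determine : (P Q : SetPartition n) → (∀ {a b} → Bump P a b → Bump Q a b) →
  (∀ {a b} → Bump Q a b → Bump P a b) → Setoid._≈_ (partitionSetoid n) P Q
bumps-determine P Q f g = isPart-mono P Q (samePart-mono P Q f) (samePart-mono Q P g)
                        , isPart-mono Q P (samePart-mono Q P g) (samePart-mono P Q f)

≈⇒bump-mono : (P Q : SetPartition n) → Setoid._≈_ (partitionSetoid n) P Q →
  ∀ {a b} → Bump P a b → Bump Q a b
≈⇒bump-mono P Q (P⊆Q , _) (a<b , p , isPart , rest) = a<b , p , P⊆Q isPart , rest

-- The partition with prescribed bumps

module FromArcs {A : Arcs n} (A? : ∀ i k → Dec (A i k))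
  (increasing : ∀ {i k} → A i k → i Fin.< k)
  (right-unique : ∀ {i k l} → A i k → A i l → k ≡ l)
  (left-unique : ∀ {i j k} → A i k → A j k → i ≡ j) where

  path-≤ : ∀ {a b} → Path A a b → a Fin.≤ b
  path-≤ []      = ℕₚ.≤-refl
  path-≤ (π ▷ a) = ℕₚ.≤-trans (path-≤ π) (ℕₚ.<⇒≤ (increasing a))

  uncons : ∀ {a b} → Path A a b → a ≡ b ⊎ ∃ λ x → A a x × Path A x b
  uncons []      = inj₁ refl
  uncons (π ▷ a) with uncons π
  ... | inj₁ refl          = inj₂ (_ , a , [])
  ... | inj₂ (x , ax , π′) = inj₂ (x , ax , π′ ▷ a)

  -- Arcs have unique successors, so paths from a common start cannot branch.
  comparable : ∀ {r a b} → Path A r a → Path A r b → Path A a b ⊎ Path A b a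
  comparable []      ρ = inj₁ ρ
  comparable (π ▷ a) ρ with comparable π ρ
  ... | inj₂ σ = inj₂ (σ ▷ a)
  ... | inj₁ σ with uncons σ
  ...   | inj₁ refl = inj₂ ([] ▷ a)
  ...   | inj₂ (x , ax , τ) with right-unique ax a
  ...     | refl = inj₁ τ

  Source : Fin n → Set
  Source r = ∀ i → ¬ A i r

  source : ∀ k → ∃ λ r → Path A r k × Source r
  source k = go (<-wellFounded (toℕ k))
    where
    go : ∀ {k} → Acc ℕ._<_ (toℕ k) → ∃ λ r → Path A r k × Source r
    go {k} (acc rec) with Finₚ.any? (λ i → A? i k)
    ... | no ¬a       = k , [] , λ i a → ¬a (i , a)
    ... | yes (i , a) = let r , π , s = go (rec (increasing a)) in r , π ▷ a , s

  source-unique : ∀ {r s k} → Source r → Source s → Path A r k → Path A s k → r ≡ s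
  source-unique r! s! []      []      = refl
  source-unique r! s! []      (ρ ▷ b) = ⊥-elim (r! _ b)
  source-unique r! s! (π ▷ a) []      = ⊥-elim (s! _ a)
  source-unique r! s! (π ▷ a) (ρ ▷ b) with left-unique a b
  ... | refl = source-unique r! s! π ρ

  -- The arcs form disjoint increasing chains; the first element of a chain serves as its canonical
  -- label.
  root : Fin n → Fin n
  root k = proj₁ (source k)

  root-path : ∀ {a b} → Path A a b → root a ≡ root b
  root-path {a} {b} π with source a | source b
  ... | r , ρ , r! | s , σ , s! = source-unique r! s! (ρ ++ π) σ
    where
    _++_ : ∀ {a b c} → Path A a b → Path A b c → Path A a c
    π ++ []      = π
    π ++ (ρ ▷ a) = (π ++ ρ) ▷ a

  root-comparable : ∀ {a b} → root a ≡ root b → Path A a b ⊎ Path A b a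
  root-comparable {a} {b} eq =
    comparable (proj₁ (proj₂ (source a))) (subst (λ r → Path A r b) (sym eq) (proj₁ (proj₂ (source b))))

  root-path⁻ : ∀ {a b} → root a ≡ root b → a Fin.≤ b → Path A a b
  root-path⁻ eq a≤b with root-comparable eq
  ... | inj₁ π = π
  ... | inj₂ π with Finₚ.≤-antisym a≤b (path-≤ π)
  ...   | refl = []

  hasRoot? : ∀ r → Decidable λ k → root k ≡ r
  hasRoot? r k = root k Finₚ.≟ r

  class : Fin n → Subset n
  class r = comprehension (hasRoot? r)

  partition : SetPartition n
  partition = record
    { IsPart   = λ p → ∃ λ k → p ≡ class (root k)
    ; nonempty = λ { (k , refl) → k , ∈-comprehension⁺ (hasRoot? (root k)) refl }
    ; covers   = λ i → class (root i) , ((i , refl) , ∈-comprehension⁺ (hasRoot? (root i)) refl)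
                     , λ { ((k , refl) , i∈) → cong class (∈-comprehension⁻ (hasRoot? (root k)) i∈) }
    }

  samePart⇒root : ∀ {a b} → SamePart partition a b → root a ≡ root b
  samePart⇒root (_ , (k , refl) , a∈ , b∈) =
    trans (∈-comprehension⁻ (hasRoot? (root k)) a∈) (sym (∈-comprehension⁻ (hasRoot? (root k)) b∈))

  root⇒samePart : ∀ {a b} → root a ≡ root b → SamePart partition a b
  root⇒samePart {a} {b} eq = class (root b) , (b , refl)
    , ∈-comprehension⁺ (hasRoot? (root b)) eq , ∈-comprehension⁺ (hasRoot? (root b)) refl

  -- The chain leads from `a` to `b`. Its first arc cannot end strictly before `b`, since that end
  -- would lie inside the bump.
  bump⇒arc : ∀ {a b} → Bump partition a b → A a b
  bump⇒arc {a} {b} bump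
    with uncons (root-path⁻ (samePart⇒root (bump⇒samePart partition bump)) (ℕₚ.<⇒≤ (proj₁ bump)))
  ... | inj₁ refl = ⊥-elim (ℕₚ.<-irrefl refl (proj₁ bump))
  ... | inj₂ (x , ax , π) with x Finₚ.≟ b
  ...   | yes refl = ax
  ...   | no x≢b   = ⊥-elim (bump-gap partition bump (root⇒samePart (root-path ([] ▷ ax)))
                       (increasing ax , Finₚ.≤∧≢⇒< (path-≤ π) x≢b))

  arc⇒bump : ∀ {a b} → A a b → Bump partition a b
  arc⇒bump {a} {b} ab = mkBump partition (increasing ab) (root⇒samePart (root-path ([] ▷ ab))) gap
    where
    gap : ∀ c → SamePart partition a c → ¬ (a Fin.< c × c Fin.< b)
    gap c ac (a<c , c<b) with uncons (root-path⁻ (samePart⇒root ac) (ℕₚ.<⇒≤ a<c))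
    ... | inj₁ refl = ℕₚ.<-irrefl refl a<c
    ... | inj₂ (x , ax , π) with right-unique ax ab
    ...   | refl = ℕₚ.<⇒≱ c<b (path-≤ π)

-- Partitions with greedy bumps and their codes

module PartitionCode (reg : Fin n → ℕ) (reg-mono : ∀ {i j} → i Fin.≤ j → reg i ℕ.≤ reg j)
  {r} (_≼_ : Fin n → Fin n → Set r)
  (≼-total : ∀ i j → i ≼ j ⊎ j ≼ i)
  (≼-trans : ∀ {i j k} → i ≼ j → j ≼ k → i ≼ k)
  (≼-antisym : ∀ {i j} → i ≼ j → j ≼ i → i ≡ j) where

  open Matchings reg reg-mono
  open Greedy _≼_ ≼-total ≼-trans ≼-antisym

  Separated : SetPartition n → Set
  Separated P = ∀ i j → i ≢ j → reg i ≡ reg j → ¬ SamePart P i j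

  partitionCode : SetPartition n → Code n
  partitionCode P = openers (bump? P) , closers (bump? P)

  bump-matching : ∀ {P} → Separated P → IsMatching (openers (bump? P)) (closers (bump? P)) (Bump P)
  bump-matching {P} sep = openers×closers-matching (bump? P) (bump-right-unique P) (bump-left-unique P)
    λ {i} {k} bump → ℕₚ.≤∧≢⇒< (reg-mono (ℕₚ.<⇒≤ (proj₁ bump)))
      (λ eq → sep i k (Finₚ.<⇒≢ (proj₁ bump)) eq (bump⇒samePart P bump))

  module _ (K : SetPartition n → Set)
    (K⇒ : ∀ {P} → K P → Separated P × IsGreedy (Bump P))
    (K⇐ : ∀ {P} → Separated P → IsGreedy (Bump P) → K P) where

    partitions : Setoid _ _
    partitions = On.setoid {B = Σ (SetPartition n) K} (partitionSetoid n) proj₁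

    -- Uniqueness of the greedy matching recovers the bumps, and the bumps recover the partition;
    -- conversely, the greedy matching of a ballot pair is the set of bumps of the partition into
    -- its chains.
    greedy-encoding : IsEncoding partitions Ballot (partitionCode ∘ proj₁)
    greedy-encoding = record
      { congruent  = λ {(P , KP)} {(Q , KQ)} P≈Q → matching-code (bump? P)
          (matching-map (bump-matching {Q} (proj₁ (K⇒ KQ)))
            (≈⇒bump-mono P Q P≈Q) (≈⇒bump-mono Q P (Setoid.sym (partitionSetoid n) {P} {Q} P≈Q)))
      ; injective  = λ {(P , KP)} {(Q , KQ)} eq →
          let sepP , gP = K⇒ KP
              sepQ , gQ = K⇒ KQ
              M = bump-matching {P} sepP
              N = subst (λ c → IsMatching (proj₁ c) (proj₂ c) (Bump Q)) (sym eq) (bump-matching {Q} sepQ)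
          in bumps-determine P Q (greedy-unique M gP N gQ) (greedy-unique N gQ M gP)
      ; valid      = λ (P , KP) → matching⇒ballot (bump-matching {P} (proj₁ (K⇒ KP)))
      ; surjective = surj
      }
      where
      surj : ∀ c → Ballot c → ∃ λ (PK : Σ (SetPartition n) K) → partitionCode (proj₁ PK) ≡ c
      surj (O , C) ballot with greedy-exists ballot
      ... | A , A? , M , g = (partition , K⇐ sep (λ a b → g (bump⇒arc a) (bump⇒arc b)))
                           , matching-code (bump? partition) (matching-map M bump⇒arc arc⇒bump)
        where
        module M = IsMatching M
        increasing : ∀ {i k} → A i k → i Fin.< k
        increasing a = ℕₚ.≰⇒> (λ k≤i → ℕₚ.<⇒≱ (M.ascending a) (reg-mono k≤i))
        open FromArcs A? increasing M.right-unique M.left-unique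
        -- Every arc raises the region, so a chain meets each region at most once.
        path-reg : ∀ {a b} → Path A a b → a ≡ b ⊎ reg a ℕ.< reg b
        path-reg []      = inj₁ refl
        path-reg (π ▷ a) = inj₂ (ℕₚ.≤-<-trans (reg-mono (path-≤ π)) (M.ascending a))
        sep : Separated partition
        sep i j i≢j eq ij with root-comparable (samePart⇒root ij)
        ... | inj₁ π = [ i≢j , ℕₚ.<-irrefl eq ]′ (path-reg π)
        ... | inj₂ π = [ i≢j ∘ sym , ℕₚ.<-irrefl (sym eq) ]′ (path-reg π)

-- Permutations

value : Permutation′ n → Fin n → ℕ
value w x = toℕ (w ⟨$⟩ʳ x)

value-injective : (w : Permutation′ n) → ∀ {x y} → value w x ≡ value w y → x ≡ y
value-injective w eq =
  trans (sym (inverseˡ w)) (trans (cong (w ⟨$⟩ˡ_) (Finₚ.toℕ-injective eq)) (inverseˡ w))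

value-surjective : (w : Permutation′ n) → ∀ {t} → t ℕ.< n → ∃ λ x → value w x ≡ t
value-surjective w t<n = w ⟨$⟩ˡ fromℕ< t<n , trans (cong toℕ (inverseʳ w)) (Finₚ.toℕ-fromℕ< t<n)

-- Reading positions by increasing value, the closer `k` comes immediately before its opener `i`.
InverseDescent : Permutation′ n → Arcs n
InverseDescent w i k = i Fin.< k × value w i ≡ suc (value w k)

inverseDescent? : (w : Permutation′ n) → ∀ i k → Dec (InverseDescent w i k)
inverseDescent? w i k = i Finₚ.<? k ×-dec value w i ℕ.≟ suc (value w k)

inverseDescent-right-unique : (w : Permutation′ n) → ∀ {i k l} →
  InverseDescent w i k → InverseDescent w i l → k ≡ l
inverseDescent-right-unique w (_ , e) (_ , f) = value-injective w (ℕₚ.suc-injective (trans (sym e) f))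

inverseDescent-left-unique : (w : Permutation′ n) → ∀ {i j k} →
  InverseDescent w i k → InverseDescent w j k → i ≡ j
inverseDescent-left-unique w (_ , e) (_ , f) = value-injective w (trans e (sym f))

module Words (reg : Fin n → ℕ) (reg-mono : ∀ {i j} → i Fin.≤ j → reg i ℕ.≤ reg j) where

  open Matchings reg reg-mono

  reg<⇒< : ∀ {i j} → reg i ℕ.< reg j → i Fin.< j
  reg<⇒< i<j = ℕₚ.≰⇒> (λ j≤i → ℕₚ.<⇒≱ i<j (reg-mono j≤i))

  infix 4 _≼_

  _≼_ : Fin n → Fin n → Set
  i ≼ j = reg j ℕ.< reg i ⊎ reg i ≡ reg j × i Fin.≤ j

  ≼-total : ∀ i j → i ≼ j ⊎ j ≼ i
  ≼-total i j with ℕₚ.<-cmp (reg i) (reg j) | Finₚ.≤-total i j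
  ... | tri< i<j _ _ | _        = inj₂ (inj₁ i<j)
  ... | tri> _ _ j<i | _        = inj₁ (inj₁ j<i)
  ... | tri≈ _ eq _  | inj₁ i≤j = inj₁ (inj₂ (eq , i≤j))
  ... | tri≈ _ eq _  | inj₂ j≤i = inj₂ (inj₂ (sym eq , j≤i))

  ≼-trans : ∀ {i j k} → i ≼ j → j ≼ k → i ≼ k
  ≼-trans (inj₁ p)       (inj₁ q)       = inj₁ (ℕₚ.<-trans q p)
  ≼-trans (inj₁ p)       (inj₂ (e , _)) = inj₁ (ℕₚ.≤-<-trans (ℕₚ.≤-reflexive (sym e)) p)
  ≼-trans (inj₂ (e , _)) (inj₁ q)       = inj₁ (ℕₚ.<-≤-trans q (ℕₚ.≤-reflexive (sym e)))
  ≼-trans (inj₂ (e , p)) (inj₂ (f , q)) = inj₂ (trans e f , ℕₚ.≤-trans p q)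

  ≼⇒reg≤ : ∀ {i j} → i ≼ j → reg j ℕ.≤ reg i
  ≼⇒reg≤ (inj₁ p)       = ℕₚ.<⇒≤ p
  ≼⇒reg≤ (inj₂ (e , _)) = ℕₚ.≤-reflexive (sym e)

  ≼⇒≤ : ∀ {i j} → reg i ≡ reg j → i ≼ j → i Fin.≤ j
  ≼⇒≤ eq (inj₁ p)       = ⊥-elim (ℕₚ.<-irrefl (sym eq) p)
  ≼⇒≤ eq (inj₂ (_ , q)) = q

  ≼-antisym : ∀ {i j} → i ≼ j → j ≼ i → i ≡ j
  ≼-antisym p q = Finₚ.≤-antisym (≼⇒≤ eq p) (≼⇒≤ (sym eq) q)
    where eq = ℕₚ.≤-antisym (≼⇒reg≤ q) (≼⇒reg≤ p)

  IncreasingInRegions : Permutation′ n → Set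
  IncreasingInRegions w = ∀ {i j} → reg i ≡ reg j → i Fin.< j → value w i ℕ.< value w j

  Avoiding : Permutation′ n → Set
  Avoiding w = ∀ {i j k} → InverseDescent w i k → reg i ℕ.< reg j → reg j ℕ.< reg k →
    value w j ℕ.< value w i

  module _ {w : Permutation′ n} (inc : IncreasingInRegions w) (avoid : Avoiding w) where

    -- If `y` lay in a region strictly between those of `x` and `p`, avoidance would have placed it
    -- earlier in the reading; inside the region of `x`, values increase.
    descent-least : ∀ {x p y} → InverseDescent w x p → value w x ℕ.≤ value w y → reg y ℕ.< reg p → x ≼ y
    descent-least {x} {p} {y} arc x≤y y<p with ℕₚ.<-cmp (reg x) (reg y)
    ... | tri< x<y _ _ = ⊥-elim (ℕₚ.<⇒≱ (avoid arc x<y y<p) x≤y)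
    ... | tri> _ _ y<x = inj₁ y<x
    ... | tri≈ _ eq _  = inj₂ (eq , ℕₚ.≮⇒≥ (λ y<x → ℕₚ.<⇒≱ (inc (sym eq) y<x) x≤y))

    -- Reading the positions by increasing value, the only way back to the left of an
    -- unread y is an inverse descent, which by avoidance must land in the region of y or
    -- to its right; so if y opens no arc and is passed over, it is never reached.
    ascent-least : ∀ {x y} → value w x ℕ.≤ value w y →
      (∀ z → reg z ≡ reg y → z Fin.< y → value w z ℕ.< value w x) →
      (∀ k → ¬ InverseDescent w y k) → x Fin.≤ y
    ascent-least {x} {y} x≤y head ¬open = ℕₚ.≮⇒≥ λ y<x → ℕₚ.<-irrefl refl
      (beyond y<x (value w y ℕ.∸ value w x) y (sym (ℕₚ.m+[n∸m]≡n x≤y)) ℕₚ.≤-refl)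
      where
      beyond : y Fin.< x → ∀ d z → value w z ≡ value w x ℕ.+ d → value w z ℕ.≤ value w y → reg y ℕ.< reg z
      -- Here `d` counts the values read since `x`. Every `z` read from `x` up to `y` is shown to
      -- lie in a region after that of `y`, which is absurd for `z = y`.
      beyond y<x zero z eq z≤y with value-injective w (trans eq (ℕₚ.+-identityʳ _))
      ... | refl = ℕₚ.≤∧≢⇒< (reg-mono (ℕₚ.<⇒≤ y<x)) (λ e → ℕₚ.<⇒≱ (inc e y<x) x≤y)
      beyond y<x (suc d) z eq z≤y
        with value-surjective w (ℕₚ.<-trans (ℕₚ.≤-reflexive (trans (sym (ℕₚ.+-suc _ d)) (sym eq))) (Finₚ.toℕ<n (w ⟨$⟩ʳ z)))
      ... | z′ , eq′ with trans eq (trans (ℕₚ.+-suc _ d) (cong suc (sym eq′)))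
      ... | z≡1+z′ with beyond y<x d z′ eq′ (ℕₚ.≤-trans (ℕₚ.n≤1+n _) (ℕₚ.≤-trans (ℕₚ.≤-reflexive (sym z≡1+z′)) z≤y)) | Finₚ.<-cmp z z′
      ... | y<z′ | tri≈ _ refl _ = ⊥-elim (ℕₚ.1+n≢n (sym z≡1+z′))
      ... | y<z′ | tri> _ _ z′<z = ℕₚ.<-≤-trans y<z′ (reg-mono (ℕₚ.<⇒≤ z′<z))
      ... | y<z′ | tri< z<z′ _ _ with ℕₚ.<-cmp (reg z) (reg y) | Finₚ.<-cmp z y
      ... | tri> _ _ y<z | _ = y<z
      ... | tri< z<y _ _ | _ = ⊥-elim (ℕₚ.<⇒≱ (avoid (z<z′ , z≡1+z′) z<y y<z′) z≤y)
      ... | tri≈ _ e _ | tri< z<y _ _ =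
        ⊥-elim (ℕₚ.<⇒≱ (head z e z<y) (ℕₚ.≤-trans (ℕₚ.m≤m+n _ (suc d)) (ℕₚ.≤-reflexive (sym eq))))
      ... | tri≈ _ e _ | tri≈ _ refl _ = ⊥-elim (¬open z′ (z<z′ , z≡1+z′))
      ... | tri≈ _ e _ | tri> _ _ y<z = ⊥-elim (ℕₚ.<⇒≱ (inc (sym e) y<z) z≤y)

  module _ {O C : Subset n} {w w′ : Permutation′ n}
    (inc : IncreasingInRegions w) (avoid : Avoiding w) (M : IsMatching O C (InverseDescent w))
    (inc′ : IncreasingInRegions w′) (avoid′ : Avoiding w′) (M′ : IsMatching O C (InverseDescent w′)) where

    private
      module M = IsMatching M
      module M′ = IsMatching M′

    -- Strong induction on the value: once both words agree below `t`, the common position `p` of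
    -- the preceding value decides which rule applies. If `p` is a closer, both next positions are
    -- its openers and `descent-least` compares them; otherwise neither is an opener and
    -- `ascent-least` does.
    same-position : ∀ {t} → Acc ℕ._<_ t → ∀ {x y} → value w x ≡ t → value w′ y ≡ t → x ≡ y
    same-position {t} (acc rec) {x} {y} wx w′y = by-cases t refl
      where
      agree : ∀ {z} → value w z ℕ.< t → value w′ z ≡ value w z
      agree {z} z<t with value-surjective w′ (Finₚ.toℕ<n (w ⟨$⟩ʳ z))
      ... | z′ , e with same-position (rec z<t) refl e
      ... | refl = e

      agree′ : ∀ {z} → value w′ z ℕ.< t → value w z ≡ value w′ z
      agree′ {z} z<t with value-surjective w (Finₚ.toℕ<n (w′ ⟨$⟩ʳ z))
      ... | z′ , e with same-position (rec z<t) e refl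
      ... | refl = e

      x≤y : value w x ℕ.≤ value w y
      x≤y = ℕₚ.≮⇒≥ λ y<x → let y<t = subst (_ ℕ.<_) wx y<x in
        ℕₚ.<-irrefl (trans (sym (agree y<t)) w′y) y<t

      y≤x : value w′ y ℕ.≤ value w′ x
      y≤x = ℕₚ.≮⇒≥ λ x<y → let x<t = subst (_ ℕ.<_) w′y x<y in
        ℕₚ.<-irrefl (trans (sym (agree′ x<t)) wx) x<t

      both-ascents : x ∉ O → y ∉ O → x ≡ y
      both-ascents x∉O y∉O = Finₚ.≤-antisym
        (ascent-least {w} inc avoid x≤y
          (λ z e z<y → let z<t = subst (_ ℕ.<_) w′y (inc′ e z<y) in
             subst (_ ℕ.<_) (sym wx) (subst (ℕ._< t) (sym (agree′ z<t)) z<t))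
          (λ k a → y∉O (M.opener a)))
        (ascent-least {w′} inc′ avoid′ y≤x
          (λ z e z<x → let z<t = subst (_ ℕ.<_) wx (inc e z<x) in
             subst (_ ℕ.<_) (sym w′y) (subst (ℕ._< t) (sym (agree z<t)) z<t))
          (λ k a → x∉O (M′.opener a)))

      by-cases : ∀ s → t ≡ s → x ≡ y
      -- An opener carries a successor value, so the position of value zero opens nothing.
      by-cases zero refl = both-ascents
        (λ x∈O → ℕₚ.0≢1+n (trans (sym wx) (proj₂ (proj₂ (M.outgoing x∈O)))))
        (λ y∈O → ℕₚ.0≢1+n (trans (sym w′y) (proj₂ (proj₂ (M′.outgoing y∈O)))))
      by-cases (suc s) refl
        with value-surjective w (ℕₚ.<-trans (ℕₚ.≤-reflexive (sym wx)) (Finₚ.toℕ<n (w ⟨$⟩ʳ x)))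
      ... | p , wp with agree {p} (ℕₚ.≤-reflexive (cong suc wp)) | p ∈? C
      ... | w′p | yes p∈C with M.incoming p∈C | M′.incoming p∈C
      ...   | i , a | j , b
              with value-injective w (trans (proj₂ a) (trans (cong suc wp) (sym wx)))
                 | value-injective w′ (trans (proj₂ b) (trans (cong suc (trans w′p wp)) (sym w′y)))
      ...     | refl | refl = ≼-antisym
                (descent-least {w} inc avoid a x≤y (M′.ascending b))
                (descent-least {w′} inc′ avoid′ b y≤x (M.ascending a))
      by-cases (suc s) refl | p , wp | w′p | no p∉C = both-ascents
        (λ x∈O → let k , a = M.outgoing x∈O in
          p∉C (subst (_∈ C) (value-injective w (trans (ℕₚ.suc-injective (trans (sym (proj₂ a)) wx)) (sym wp))) (M.closer a)))
        (λ y∈O → let k , a = M′.outgoing y∈O in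
          p∉C (subst (_∈ C) (value-injective w′ (trans (ℕₚ.suc-injective (trans (sym (proj₂ a)) w′y)) (sym (trans w′p wp)))) (M′.closer a)))

    words-equal : ∀ x → w ⟨$⟩ʳ x ≡ w′ ⟨$⟩ʳ x
    words-equal x with value-surjective w′ (Finₚ.toℕ<n (w ⟨$⟩ʳ x))
    ... | y , e with same-position (<-wellFounded (value w x)) refl e
    ... | refl = Finₚ.toℕ-injective (sym e)

-- Reading a permutation off its code

-- Lists hold the reading in reverse, so `o` is the entry read immediately after `q`.
data Consecutive {a} {A : Set a} (o q : A) : List A → Set a where
  here  : ∀ {L} → Consecutive o q (o ∷ q ∷ L)
  there : ∀ {x L} → Consecutive o q L → Consecutive o q (x ∷ L)

module _ {a} {A : Set a} where

  consecutive-∈ˡ : ∀ {o q} {L : List A} → Consecutive o q L → o ∈ˡ L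
  consecutive-∈ˡ here      = here refl
  consecutive-∈ˡ (there c) = there (consecutive-∈ˡ c)

  consecutive-∈ʳ : ∀ {o q x} {L : List A} → Consecutive o q (x ∷ L) → q ∈ˡ L
  consecutive-∈ʳ here                = here refl
  consecutive-∈ʳ (there c@here)      = there (consecutive-∈ʳ c)
  consecutive-∈ʳ (there c@(there _)) = there (consecutive-∈ʳ c)

  head⊎consecutive : ∀ {q} {L : List A} → q ∈ˡ L →
    (∃ λ L′ → L ≡ q ∷ L′) ⊎ (∃ λ o → Consecutive o q L)
  head⊎consecutive (here refl) = inj₁ (_ , refl)
  head⊎consecutive (there q∈) with head⊎consecutive q∈
  ... | inj₁ (_ , refl) = inj₂ (_ , here)
  ... | inj₂ (o , c)    = inj₂ (o , there c)

  consecutive-functionalˡ : ∀ {o o′ q} {L : List A} → Unique L →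
    Consecutive o q L → Consecutive o′ q L → o ≡ o′
  consecutive-functionalˡ u             here      here       = refl
  consecutive-functionalˡ (_ ∷ px ∷ _)  here      (there c′) = ⊥-elim (All.lookup px (consecutive-∈ʳ c′) refl)
  consecutive-functionalˡ (_ ∷ px ∷ _)  (there c) here       = ⊥-elim (All.lookup px (consecutive-∈ʳ c) refl)
  consecutive-functionalˡ (_ ∷ u)       (there c) (there c′) = consecutive-functionalˡ u c c′

  consecutive-functionalʳ : ∀ {o q q′} {L : List A} → Unique L →
    Consecutive o q L → Consecutive o q′ L → q ≡ q′
  consecutive-functionalʳ u        here      here       = refl
  consecutive-functionalʳ (px ∷ _) here      (there c′) = ⊥-elim (All.lookup px (consecutive-∈ˡ c′) refl)
  consecutive-functionalʳ (px ∷ _) (there c) here       = ⊥-elim (All.lookup px (consecutive-∈ˡ c) refl)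
  consecutive-functionalʳ (_ ∷ u)  (there c) (there c′) = consecutive-functionalʳ u c c′

  -- Counted from the end of the list, since lists are read with the most recent entry first.
  position : ∀ {x} {L : List A} → x ∈ˡ L → ℕ
  position {L = _ ∷ L} (here _)  = length L
  position             (there e) = position e

  position< : ∀ {x} {L : List A} (e : x ∈ˡ L) → position e ℕ.< length L
  position< (here _)  = ℕₚ.≤-refl
  position< (there e) = ℕₚ.m<n⇒m<1+n (position< e)

  position-injective : ∀ {x y} {L : List A} (e : x ∈ˡ L) (e′ : y ∈ˡ L) → position e ≡ position e′ → x ≡ y
  position-injective (here refl) (here refl) eq = refl
  position-injective (here _)    (there e′)  eq = ⊥-elim (ℕₚ.<-irrefl (sym eq) (position< e′))
  position-injective (there e)   (here _)    eq = ⊥-elim (ℕₚ.<-irrefl eq (position< e))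
  position-injective (there e)   (there e′)  eq = position-injective e e′ eq

  consecutive⇒position : ∀ {o q} {L : List A} → Unique L → Consecutive o q L →
    (e : o ∈ˡ L) (e′ : q ∈ˡ L) → position e ≡ suc (position e′)
  consecutive⇒position u            here      (here _)    (there (here _))   = refl
  consecutive⇒position (px ∷ _)     here      (here _)    (here refl)        = ⊥-elim (All.lookup px (here refl) refl)
  consecutive⇒position (_ ∷ px ∷ _) here      (here _)    (there (there e′)) = ⊥-elim (All.lookup px e′ refl)
  consecutive⇒position (px ∷ _)     here      (there e)   e′                 = ⊥-elim (All.lookup px e refl)
  consecutive⇒position (px ∷ _)     (there c) (here refl) e′                 = ⊥-elim (All.lookup px (consecutive-∈ˡ c) refl)
  consecutive⇒position (px ∷ _)     c@(there _) (there e) (here refl)        = ⊥-elim (All.lookup px (consecutive-∈ʳ c) refl)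
  consecutive⇒position (_ ∷ u)      (there c) (there e)   (there e′)         = consecutive⇒position u c e e′

  position⇒consecutive : ∀ {o q} {L : List A} (e : o ∈ˡ L) (e′ : q ∈ˡ L) →
    position e ≡ suc (position e′) → Consecutive o q L
  position⇒consecutive (here _)    (here _)           eq = ⊥-elim (ℕₚ.1+n≢n (sym eq))
  position⇒consecutive (here refl) (there (here refl)) eq = here
  position⇒consecutive (here _)    (there (there e′)) eq = ⊥-elim (ℕₚ.<-irrefl (sym (ℕₚ.suc-injective eq)) (position< e′))
  position⇒consecutive (there e)   (here _)           eq = ⊥-elim (ℕₚ.<-asym (position< e) (ℕₚ.≤-reflexive (sym eq)))
  position⇒consecutive (there e)   (there e′)         eq = there (position⇒consecutive e e′ eq)

unique⇒length≤ : {L : List (Fin n)} → Unique L → length L ℕ.≤ n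
unique⇒length≤ u = Finₚ.injective⇒≤ (lookup-injective u _ _)

open module FinMembership {n} = DecMembership (Finₚ._≟_ {n}) using () renaming (_∈?_ to _∈ˡ?_)

-- Runs of the two reading rules

module Reading (reg : Fin n → ℕ) (reg-mono : ∀ {i j} → i Fin.≤ j → reg i ℕ.≤ reg j)
  (O C : Subset n) where

  open Matchings reg reg-mono
  open Words reg reg-mono

  data Idle : List (Fin n) → Set where
    []  : Idle []
    _∷_ : ∀ {p} → p ∉ C → ∀ L → Idle (p ∷ L)

  Head : List (Fin n) → Fin n → Set
  Head L x = x ∉ˡ L × (∀ z → reg z ≡ reg x → z Fin.< x → z ∈ˡ L)

  head? : ∀ L → Decidable (Head L)
  head? L x = ¬? (x ∈ˡ? L) ×-dec Finₚ.all? (λ z → reg z ℕ.≟ reg x →-dec (z Finₚ.<? x →-dec z ∈ˡ? L))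

  -- The two rules that descent-least and ascent-least force upon the reading
  -- by increasing value.
  data Step : List (Fin n) → Fin n → Set where
    down : ∀ {p L x} → p ∈ C → Head (p ∷ L) x → reg x ℕ.< reg p →
           (∀ y → y ∉ˡ p ∷ L → reg y ℕ.< reg p → x ≼ y) → Step (p ∷ L) x
    up   : ∀ {L x} → Idle L → Head L x → x ∉ O →
           (∀ y → Head L y → y ∉ O → x Fin.≤ y) → Step L x

  data Run : List (Fin n) → Set where
    []  : Run []
    _◁_ : ∀ {L x} → Run L → Step L x → Run (x ∷ L)

  step-head : ∀ {L x} → Step L x → Head L x
  step-head (down _ h _ _) = h
  step-head (up _ h _ _)   = h

  fresh : ∀ {x L} → Run (x ∷ L) → x ∉ˡ L
  fresh (_ ◁ s) = proj₁ (step-head s)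

  run-unique : ∀ {L} → Run L → Unique L
  run-unique []          = []
  run-unique r@(ρ ◁ _) = All.tabulate (λ { y∈ refl → fresh r y∈ }) ∷ run-unique ρ

  run-closed : ∀ {L} → Run L → ∀ {x y} → x ∈ˡ L → reg y ≡ reg x → y Fin.< x → y ∈ˡ L
  run-closed (ρ ◁ s) (here refl) eq y<x = there (proj₂ (step-head s) _ eq y<x)
  run-closed (ρ ◁ s) (there x∈)  eq y<x = there (run-closed ρ x∈ eq y<x)

  pop-head : ∀ {x L y} → Head (x ∷ L) y → reg y ℕ.< reg x → Head L y
  pop-head {x} {L} {y} (y∉ , closed) y<x = y∉ ∘ there , λ z eq z<y → drop eq (closed z eq z<y)
    where
    drop : ∀ {z} → reg z ≡ reg y → z ∈ˡ x ∷ L → z ∈ˡ L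
    drop eq (here refl) = ⊥-elim (ℕₚ.<-irrefl (sym eq) y<x)
    drop eq (there z∈)  = z∈

  -- An `up` step takes the leftmost head outside `O`, so only openers remain as heads to its left.
  -- A `down` step moves left, where the heads in still earlier regions were already heads before
  -- it.
  heads-left-open : ∀ {p L} → Run (p ∷ L) → ∀ {y} → Head (p ∷ L) y → reg y ℕ.< reg p → y ∈ O
  heads-left-open (ρ ◁ down _ _ x<p _) h y<x =
    heads-left-open ρ (pop-head h y<x) (ℕₚ.<-trans y<x x<p)
  heads-left-open (ρ ◁ up _ _ _ lowest) {y} h y<x with y ∈? O
  ... | yes y∈O = y∈O
  ... | no y∉O  = ⊥-elim (ℕₚ.<⇒≱ y<x (reg-mono (lowest y (pop-head h y<x) y∉O)))

  opener-predecessor : ∀ {L} → Run L → ∀ {o} → o ∈ˡ L → o ∈ O → ∃ λ q → Consecutive o q L × q ∈ C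
  opener-predecessor (ρ ◁ down p∈C _ _ _) (here refl) o∈O = _ , here , p∈C
  opener-predecessor (ρ ◁ up _ _ o∉O _)   (here refl) o∈O = ⊥-elim (o∉O o∈O)
  opener-predecessor (ρ ◁ _)              (there o∈)  o∈O =
    let q , c , q∈C = opener-predecessor ρ o∈ o∈O in q , there c , q∈C

  -- Only a `down` step can follow a closer, and `heads-left-open` makes its target an opener. What
  -- is unread now was unread then, so the minimality of that step persists.
  closer-successor : ∀ {L} → Run L → ∀ {o q} → Consecutive o q L → q ∈ C →
    o ∈ O × reg o ℕ.< reg q × (∀ z → z ∉ˡ L → reg z ℕ.< reg q → o ≼ z)
  closer-successor (ρ ◁ down _ h o<q lowest)  here      q∈C =
    heads-left-open ρ h o<q , o<q , λ z z∉ → lowest z (z∉ ∘ there)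
  closer-successor (ρ ◁ up (q∉C ∷ _) _ _ _)   here      q∈C = ⊥-elim (q∉C q∈C)
  closer-successor (ρ ◁ _)                    (there c) q∈C =
    let o∈O , o<q , lowest = closer-successor ρ c q∈C in o∈O , o<q , λ z z∉ → lowest z (z∉ ∘ there)

  -- Ensures that no inverse descent arises after a non-closer: a head in a region before that of
  -- `q` would be an opener, which `up` refuses, and inside one region the reading goes left to
  -- right.
  idle-successor : ∀ {L} → Run L → ∀ {o q} → Consecutive o q L → q ∉ C → q Fin.< o
  idle-successor (ρ ◁ _)                  (there c) q∉C = idle-successor ρ c q∉C
  idle-successor (ρ ◁ down q∈C _ _ _)     here      q∉C = ⊥-elim (q∉C q∈C)
  idle-successor (ρ ◁ up _ h o∉O _) {o} {q} here    q∉C with ℕₚ.<-cmp (reg o) (reg q)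
  ... | tri< o<q _ _ = ⊥-elim (o∉O (heads-left-open ρ h o<q))
  ... | tri> _ _ q<o = reg<⇒< q<o
  ... | tri≈ _ eq _ with Finₚ.<-cmp q o
  ...   | tri< q<o _ _  = q<o
  ...   | tri≈ _ refl _ = ⊥-elim (proj₁ h (here refl))
  ...   | tri> _ _ o<q  = ⊥-elim (proj₁ h (run-closed ρ (here refl) eq o<q))

  run-increasing : ∀ {L} → Run L → ∀ {x y} (e : x ∈ˡ L) (e′ : y ∈ˡ L) →
    reg x ≡ reg y → x Fin.< y → position e ℕ.< position e′
  run-increasing (ρ ◁ _)   (here refl) (here refl) eq x<y = ⊥-elim (ℕₚ.<-irrefl refl x<y)
  run-increasing (ρ ◁ _)   (there e)   (here refl) eq x<y = position< e
  run-increasing r@(ρ ◁ _) (here refl) (there e′)  eq x<y = ⊥-elim (fresh r (run-closed ρ e′ eq x<y))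
  run-increasing (ρ ◁ _)   (there e)   (there e′)  eq x<y = run-increasing ρ e e′ eq x<y

  -- If `j` were read after `i`, it was a candidate when `i` followed `k`, and the order `≼` prefers
  -- its later region.
  run-avoiding : ∀ {L} → Run L → ∀ {i j k} → Consecutive i k L → k ∈ C →
    (e : i ∈ˡ L) (e′ : j ∈ˡ L) → reg i ℕ.< reg j → reg j ℕ.< reg k → position e′ ℕ.< position e
  run-avoiding (ρ ◁ _)   here      k∈C (here _)    (here refl) i<j j<k = ⊥-elim (ℕₚ.<-irrefl refl i<j)
  run-avoiding (ρ ◁ _)   here      k∈C (here _)    (there e′)  i<j j<k = position< e′
  run-avoiding r@(ρ ◁ _) here      k∈C (there e)   e′          i<j j<k = ⊥-elim (fresh r e)
  run-avoiding r@(ρ ◁ _) (there c) k∈C (here refl) e′          i<j j<k = ⊥-elim (fresh r (consecutive-∈ˡ c))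
  run-avoiding r@(ρ ◁ _) (there c) k∈C (there e)   (here refl) i<j j<k =
    ⊥-elim (ℕₚ.<⇒≱ i<j (≼⇒reg≤ (proj₂ (proj₂ (closer-successor ρ c k∈C)) _ (fresh r) j<k)))
  run-avoiding (ρ ◁ _)   (there c) k∈C (there e)   (there e′)  i<j j<k = run-avoiding ρ c k∈C e e′ i<j j<k

  -- Ballot pairs never block the reading

  module Progress (ballot : Ballot (O , C)) where

    -- If everything in earlier regions is read, each opener there was read right after a closer.
    -- That closer is not in a region beyond `p`, since then `p`, still unread, would have been
    -- preferred to the opener. So `O <ᵣ p` injects into `C ≤ᵣ p` and misses `p`, against the first
    -- inequality.
    closer-not-stuck : ∀ {p L} → Run (p ∷ L) → p ∈ C → ¬ (∀ y → ¬ (y ∉ˡ p ∷ L × reg y ℕ.< reg p))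
    closer-not-stuck {p} {L} r@(ρ ◁ _) p∈C none = ℕₚ.<-irrefl refl (ℕₚ.<-≤-trans
      (∣∣-injection-< (O <ᵣ p) (C ≤ᵣ p) (λ o q → Consecutive o q (p ∷ L)) p predecessor
        (consecutive-functionalˡ (run-unique r)) (∈-comprehension⁺ (in≤? C p) (p∈C , ℕₚ.≤-refl)))
      (proj₁ ballot p))
      where
      predecessor : ∀ {o} → o ∈ O <ᵣ p → ∃ λ q → q ∈ C ≤ᵣ p × Consecutive o q (p ∷ L) × q ≢ p
      predecessor {o} o∈ with ∈-comprehension⁻ (in<? O p) o∈
      ... | o∈O , o<p
        with opener-predecessor r (decidable-stable (o ∈ˡ? (p ∷ L)) (λ o∉ → none o (o∉ , o<p))) o∈O
      ... | q , c , q∈C = q , ∈-comprehension⁺ (in≤? C p) (q∈C , ℕₚ.≮⇒≥ (q≤p c))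
                        , c , λ { refl → fresh r (consecutive-∈ʳ c) }
        where
        q≤p : Consecutive o q (p ∷ L) → ¬ reg p ℕ.< reg q
        q≤p here       p<q = ℕₚ.<-irrefl refl o<p
        q≤p (there c′) p<q =
          ℕₚ.<⇒≱ o<p (≼⇒reg≤ (proj₂ (proj₂ (closer-successor ρ c′ q∈C)) p (fresh r) p<q))

    least-is-head : ∀ {L x} → x ∉ˡ L → (∀ z → z ∉ˡ L → reg z ≡ reg x → x ≼ z) → Head L x
    least-is-head {L} x∉ lowest = x∉ , λ z eq z<x → decidable-stable (z ∈ˡ? L)
      (λ z∉ → ℕₚ.<⇒≱ z<x (≼⇒≤ (sym eq) (lowest z z∉ eq)))

    closer-step : ∀ {p L} → Run (p ∷ L) → p ∈ C → ∃ λ x → Step (p ∷ L) x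
    closer-step {p} {L} r p∈C
      with least (λ y → ¬? (y ∈ˡ? (p ∷ L)) ×-dec reg y ℕ.<? reg p) _≼_ ≼-total ≼-trans
    ... | inj₁ none = ⊥-elim (closer-not-stuck r p∈C none)
    ... | inj₂ (x , (x∉ , x<p) , lowest) = x , down p∈C
      (least-is-head x∉ (λ z z∉ eq → lowest z (z∉ , subst (ℕ._< reg p) (sym eq) x<p)))
      x<p (λ y y∉ y<p → lowest y (y∉ , y<p))

    -- All closers in regions after `y` are read, and none is the latest entry, so each is followed
    -- by an opener. That opener was chosen while `y` was a candidate, hence is in no earlier region
    -- than `y`. If `y` were an opener, it would be missed by this injection of `C >ᵣ y` into
    -- `O ≥ᵣ y`, against the second inequality.
    idle-not-stuck : ∀ {L} → Run L → Idle L → ∀ {y} → y ∉ˡ L → (∀ z → z ∉ˡ L → y ≼ z) → y ∉ O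
    idle-not-stuck {L} ρ idle {y} y∉ lowest y∈O = ℕₚ.<-irrefl refl (ℕₚ.<-≤-trans
      (∣∣-injection-< (C >ᵣ y) (O ≥ᵣ y) (λ q o → Consecutive o q L) y successor
        (consecutive-functionalʳ (run-unique ρ)) (∈-comprehension⁺ (in≥? O y) (y∈O , ℕₚ.≤-refl)))
      (proj₁ (proj₂ ballot) y))
      where
      not-last : ∀ {q L} → q ∈ C → ¬ Idle (q ∷ L)
      not-last q∈C (q∉C ∷ _) = q∉C q∈C
      successor : ∀ {q} → q ∈ C >ᵣ y → ∃ λ o → o ∈ O ≥ᵣ y × Consecutive o q L × o ≢ y
      successor {q} q∈ with ∈-comprehension⁻ (in>? C y) q∈
      ... | q∈C , y<q
        with head⊎consecutive (decidable-stable (q ∈ˡ? L) (λ q∉ → ℕₚ.<⇒≱ y<q (≼⇒reg≤ (lowest q q∉))))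
      ... | inj₁ (_ , refl) = ⊥-elim (not-last q∈C idle)
      ... | inj₂ (o , c) with closer-successor ρ c q∈C
      ... | o∈O , _ , o≼ = o , ∈-comprehension⁺ (in≥? O y) (o∈O , ≼⇒reg≤ (o≼ y y∉ y<q))
                         , c , λ { refl → y∉ (consecutive-∈ˡ c) }

    idle-step : ∀ {L} → Run L → Idle L → (∃ λ z → z ∉ˡ L) → ∃ λ x → Step L x
    idle-step {L} ρ idle (z , z∉)
      -- The first search only shows that the second succeeds: the `≼`-least unread position is a
      -- head outside `O`. The step itself takes the leftmost such head.
      with least (λ y → ¬? (y ∈ˡ? L)) _≼_ ≼-total ≼-trans
         | least (λ y → head? L y ×-dec ¬? (y ∈? O)) Fin._≤_ Finₚ.≤-total ℕₚ.≤-trans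
    ... | inj₁ none | _ = ⊥-elim (none z z∉)
    ... | inj₂ (y , y∉ , lowest) | inj₁ none =
      ⊥-elim (none y (least-is-head y∉ (λ z z∉ _ → lowest z z∉) , idle-not-stuck ρ idle y∉ lowest))
    ... | inj₂ _ | inj₂ (x , (h , x∉O) , lowest) = x , up idle h x∉O (λ y h′ y∉O → lowest y (h′ , y∉O))

    step-exists : ∀ {L} → Run L → (∃ λ z → z ∉ˡ L) → ∃ λ x → Step L x
    step-exists {[]}    ρ = idle-step ρ []
    step-exists {p ∷ L} ρ with p ∈? C
    ... | yes p∈C = λ _ → closer-step ρ p∈C
    ... | no p∉C  = idle-step ρ (p∉C ∷ L)

    complete-from : ∀ fuel {L} → Run L → n ℕ.< length L ℕ.+ fuel → ∃ λ L′ → Run L′ × (∀ x → x ∈ˡ L′)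
    complete-from zero ρ n< =
      ⊥-elim (ℕₚ.<⇒≱ (subst (n ℕ.<_) (ℕₚ.+-identityʳ _) n<) (unique⇒length≤ (run-unique ρ)))
    complete-from (suc fuel) {L} ρ n< with Finₚ.any? (λ z → ¬? (z ∈ˡ? L))
    ... | no all = L , ρ , λ x → decidable-stable (x ∈ˡ? L) (λ x∉ → all (x , x∉))
    ... | yes unread with step-exists ρ unread
    ...   | x , s = complete-from fuel (ρ ◁ s) (subst (n ℕ.<_) (ℕₚ.+-suc _ fuel) n<)

    -- The value of a position is its place in a complete run, so inverse descents are exactly the
    -- consecutive pairs that begin with a closer.
    word-exists : ∃ λ w → IncreasingInRegions w × Avoiding w × IsMatching O C (InverseDescent w)
    word-exists with complete-from (suc n) [] ℕₚ.≤-refl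
    ... | L , ρ , complete = w , inc , avoid , record
      { opener       = λ a → let c , k∈C = descent⇒consecutive a in proj₁ (closer-successor ρ c k∈C)
      ; closer       = λ a → proj₂ (descent⇒consecutive a)
      ; outgoing     = λ i∈O → let q , c , q∈C = opener-predecessor ρ (complete _) i∈O
                               in q , consecutive⇒descent c q∈C
      ; incoming     = incoming
      ; right-unique = inverseDescent-right-unique w
      ; left-unique  = inverseDescent-left-unique w
      ; ascending    = λ a → let c , k∈C = descent⇒consecutive a in proj₁ (proj₂ (closer-successor ρ c k∈C))
      }
      where
      bound : ∀ x → position (complete x) ℕ.< n
      bound x = ℕₚ.<-≤-trans (position< (complete x)) (unique⇒length≤ (run-unique ρ))

      fromPositions : Σ (Permutation′ n) λ w → ∀ x → w ⟨$⟩ʳ x ≡ fromℕ< (bound x)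
      fromPositions = injection⇒permutation (λ x → fromℕ< (bound x)) λ {x} {y} eq →
        position-injective (complete x) (complete y)
          (trans (sym (Finₚ.toℕ-fromℕ< (bound x))) (trans (cong toℕ eq) (Finₚ.toℕ-fromℕ< (bound y))))

      w : Permutation′ n
      w = proj₁ fromPositions

      value≡position : ∀ x → value w x ≡ position (complete x)
      value≡position x = trans (cong toℕ (proj₂ fromPositions x)) (Finₚ.toℕ-fromℕ< (bound x))

      value-< : ∀ {x y} → position (complete x) ℕ.< position (complete y) → value w x ℕ.< value w y
      value-< {x} {y} rewrite value≡position x | value≡position y = id

      descent⇒consecutive : ∀ {i k} → InverseDescent w i k → Consecutive i k L × k ∈ C
      descent⇒consecutive {i} {k} (i<k , eq) rewrite value≡position i | value≡position k =
        c , decidable-stable (k ∈? C) (λ k∉C → ℕₚ.<-asym i<k (idle-successor ρ c k∉C))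
        where c = position⇒consecutive (complete i) (complete k) eq

      consecutive⇒descent : ∀ {i k} → Consecutive i k L → k ∈ C → InverseDescent w i k
      consecutive⇒descent {i} {k} c k∈C = reg<⇒< (proj₁ (proj₂ (closer-successor ρ c k∈C)))
        , trans (value≡position i) (trans (consecutive⇒position (run-unique ρ) c (complete i) (complete k))
            (cong suc (sym (value≡position k))))

      incoming : ∀ {k} → k ∈ C → ∃ λ i → InverseDescent w i k
      incoming {k} k∈C with head⊎consecutive (complete k)
      -- A closer cannot be read last, because something in an earlier region would still be unread.
      ... | inj₁ (_ , refl) = ⊥-elim (closer-not-stuck ρ k∈C (λ y (y∉ , _) → y∉ (complete y)))
      ... | inj₂ (i , c)    = i , consecutive⇒descent c k∈C

      inc : IncreasingInRegions w
      inc eq i<j = value-< (run-increasing ρ (complete _) (complete _) eq i<j)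

      avoid : Avoiding w
      avoid a i<j j<k = let c , k∈C = descent⇒consecutive a in
        value-< (run-avoiding ρ c k∈C (complete _) (complete _) i<j j<k)

-- Regions of J

module Regions {m} (J : Subset m) where

  cutBefore? : ∀ (i : Fin (suc m)) → Decidable λ k → k ∉ J × k Fin.< i
  cutBefore? i k = ¬? (k ∈? J) ×-dec k Finₚ.<? i

  cutsBefore : Fin (suc m) → Subset m
  cutsBefore i = comprehension (cutBefore? i)

  -- Regions are numbered from zero by the cuts to their left, which makes the numbering monotone
  -- and turns `SameRegion` into equality of numbers.
  region : Fin (suc m) → ℕ
  region i = ∣ cutsBefore i ∣

  cutsBefore-mono : ∀ {i j} → i Fin.≤ j → cutsBefore i ⊆ cutsBefore j
  cutsBefore-mono {i} {j} i≤j k∈ = let k∉J , k<i = ∈-comprehension⁻ (cutBefore? i) k∈ in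
    ∈-comprehension⁺ (cutBefore? j) (k∉J , ℕₚ.<-≤-trans k<i i≤j)

  region-mono : ∀ {i j} → i Fin.≤ j → region i ℕ.≤ region j
  region-mono i≤j = p⊆q⇒∣p∣≤∣q∣ (cutsBefore-mono i≤j)

  region-mono-< : ∀ {i j} k → k ∉ J → i Fin.≤ k → k Fin.< j → region i ℕ.< region j
  region-mono-< {i} {j} k k∉J i≤k k<j = ∣∣-injection-< (cutsBefore i) (cutsBefore j) _≡_ k
    (λ {l} l∈ → l , cutsBefore-mono (ℕₚ.<⇒≤ (ℕₚ.≤-<-trans i≤k k<j)) l∈ , refl
      , λ { refl → ℕₚ.<⇒≱ (proj₂ (∈-comprehension⁻ (cutBefore? i) l∈)) i≤k })
    (λ e f → trans e (sym f)) (∈-comprehension⁺ (cutBefore? j) (k∉J , k<j))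

  sameRegion⇒≡ : ∀ {i j} → SameRegion J i j → region i ≡ region j
  sameRegion⇒≡ {i} {j} same = cong ∣_∣ (⊆-antisym (shift i j (λ k k∉J → Equivalence.from (same k k∉J)))
                                                   (shift j i (λ k k∉J → Equivalence.to (same k k∉J))))
    where
    shift : ∀ i j → (∀ k → k ∉ J → j Fin.≤ k → i Fin.≤ k) → cutsBefore i ⊆ cutsBefore j
    shift i j f {k} k∈ = let k∉J , k<i = ∈-comprehension⁻ (cutBefore? i) k∈ in
      ∈-comprehension⁺ (cutBefore? j) (k∉J , ℕₚ.≰⇒> (λ j≤k → ℕₚ.<⇒≱ k<i (f k k∉J j≤k)))

  ≡⇒sameRegion : ∀ {i j} → region i ≡ region j → SameRegion J i j
  ≡⇒sameRegion eq k k∉J = mk⇔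
    (λ i≤k → ℕₚ.≮⇒≥ (λ k<j → ℕₚ.<-irrefl eq (region-mono-< k k∉J i≤k k<j)))
    (λ j≤k → ℕₚ.≮⇒≥ (λ k<i → ℕₚ.<-irrefl (sym eq) (region-mono-< k k∉J j≤k k<i)))

  region-< : ∀ {i j} → i Fin.< j → ¬ SameRegion J i j → region i ℕ.< region j
  region-< i<j ¬same = ℕₚ.≤∧≢⇒< (region-mono (ℕₚ.<⇒≤ i<j)) (¬same ∘ ≡⇒sameRegion)

  <⇒¬sameRegion : ∀ {i j} → region i ℕ.< region j → ¬ SameRegion J i j
  <⇒¬sameRegion i<j same = ℕₚ.<-irrefl (sameRegion⇒≡ same) i<j

  open Matchings region region-mono
  open Words region region-mono

  -- Noncrossing and nonnesting as greedy conditions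

  module NC-code = PartitionCode region region-mono _≼_ ≼-total ≼-trans ≼-antisym
  module NN-code = PartitionCode region region-mono Fin._≤_ Finₚ.≤-total ℕₚ.≤-trans Finₚ.≤-antisym

  separates⇒separated : ∀ {P} → SeparatesRegions J P → NC-code.Separated P
  separates⇒separated sep i j i≢j eq = sep i j i≢j (≡⇒sameRegion eq)

  separated⇒separates : ∀ {P} → NC-code.Separated P → SeparatesRegions J P
  separated⇒separates sep i j i≢j same = sep i j i≢j (sameRegion⇒≡ same)

  bump-ascending : ∀ {P} → SeparatesRegions J P → ∀ {i k} → Bump P i k → region i ℕ.< region k
  bump-ascending {P} sep bump =
    region-< (proj₁ bump) (λ same → sep _ _ (Finₚ.<⇒≢ (proj₁ bump)) same (bump⇒samePart P bump))

  <⇒≢-pair : ∀ {i j k l : Fin (suc m)} → i Fin.< j → (i , k) ≢ (j , l)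
  <⇒≢-pair i<j eq = Finₚ.<⇒≢ i<j (cong proj₁ eq)

  -- Compare the regions of the openers `i` and `j`. In a common region, `j < i` would be a nesting
  -- forbidden by `nc₃`. If `i` comes from an earlier region, the bumps cross, and `nc₂` would put
  -- `j` in the region of `i` or of `k`, both excluded.
  noncrossing⇒greedy : ∀ {P} → IsNoncrossing J P →
    NC-code.Separated P × Greedy.IsGreedy _≼_ ≼-total ≼-trans ≼-antisym (Bump P)
  noncrossing⇒greedy {P} nc = separates⇒separated {P} nc₁ , greedy
    where
    open IsNoncrossing nc
    greedy : Greedy.IsGreedy _≼_ ≼-total ≼-trans ≼-antisym (Bump P)
    greedy {i} {j} {k} {l} ik jl k<l j<k with ℕₚ.<-cmp (region i) (region j)
    ... | tri> _ _ j<i = inj₁ j<i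
    ... | tri≈ _ eq _  = inj₂ (eq , ℕₚ.≮⇒≥ λ j<i →
            nc₃ j l i k jl ik (<⇒≢-pair j<i) j<i (proj₁ ik) k<l (≡⇒sameRegion (sym eq)))
    ... | tri< i<j _ _ with nc₂ i k j l ik jl (<⇒≢-pair (reg<⇒< i<j)) (reg<⇒< i<j) (reg<⇒< j<k) k<l
    ...   | inj₁ same = ⊥-elim (<⇒¬sameRegion i<j same)
    ...   | inj₂ same = ⊥-elim (ℕₚ.<-irrefl (sym (sameRegion⇒≡ same)) j<k)

  greedy⇒noncrossing : ∀ {P} → NC-code.Separated P →
    Greedy.IsGreedy _≼_ ≼-total ≼-trans ≼-antisym (Bump P) → IsNoncrossing J P
  greedy⇒noncrossing {P} sep greedy = record { nc₁ = nc₁ ; nc₂ = nc₂ ; nc₃ = nc₃ }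
    where
    nc₁ : SeparatesRegions J P
    nc₁ = separated⇒separates {P} sep
    nc₂ : ∀ i₁ i₂ j₁ j₂ → Bump P i₁ i₂ → Bump P j₁ j₂ → (i₁ , i₂) ≢ (j₁ , j₂) →
          i₁ Fin.< j₁ → j₁ Fin.< i₂ → i₂ Fin.< j₂ → SameRegion J i₁ j₁ ⊎ SameRegion J i₂ j₁
    -- Unless `j₁` shares the region of `i₂`, it was available to `i₂`; that `i₁` was chosen puts
    -- `i₁` in a region no earlier than that of `j₁`.
    nc₂ i₁ i₂ j₁ j₂ bi bj _ i<j j<i′ i′<j′ with ℕₚ.m≤n⇒m<n∨m≡n (region-mono (ℕₚ.<⇒≤ j<i′))
    ... | inj₂ eq  = inj₂ (≡⇒sameRegion (sym eq))
    ... | inj₁ lt  = inj₁ (≡⇒sameRegion (ℕₚ.≤-antisym (region-mono (ℕₚ.<⇒≤ i<j))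
                             (≼⇒reg≤ (greedy bi bj i′<j′ lt))))
    nc₃ : ∀ i₁ i₂ j₁ j₂ → Bump P i₁ i₂ → Bump P j₁ j₂ → (i₁ , i₂) ≢ (j₁ , j₂) →
          i₁ Fin.< j₁ → j₁ Fin.< j₂ → j₂ Fin.< i₂ → ¬ SameRegion J i₁ j₁
    nc₃ i₁ i₂ j₁ j₂ bi bj _ i<j j<j′ j′<i′ same = ℕₚ.<⇒≱ i<j (≼⇒≤ (sym eq)
      (greedy bj bi j′<i′ (subst (ℕ._< region j₂) (sym eq) (bump-ascending {P} nc₁ bj))))
      where eq = sameRegion⇒≡ same

  nonnesting⇒greedy : ∀ {P} → IsNonnesting J P →
    NC-code.Separated P × Greedy.IsGreedy Fin._≤_ Finₚ.≤-total ℕₚ.≤-trans Finₚ.≤-antisym (Bump P)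
  nonnesting⇒greedy {P} nn = separates⇒separated {P} nn₁ , λ ik jl k<l j<k →
    ℕₚ.≮⇒≥ λ j<i → nn₂ _ _ _ _ jl ik (<⇒≢-pair j<i) (j<i , proj₁ ik , k<l)
    where open IsNonnesting nn

  -- In a nesting, the outer opener is available to the inner closer and lies further left, so the
  -- inner arc is not greedy. `Separated` does not mention the order, so its noncrossing instance
  -- serves here too.
  greedy⇒nonnesting : ∀ {P} → NC-code.Separated P →
    Greedy.IsGreedy Fin._≤_ Finₚ.≤-total ℕₚ.≤-trans Finₚ.≤-antisym (Bump P) → IsNonnesting J P
  greedy⇒nonnesting {P} sep greedy = record
    { nn₁ = nn₁
    ; nn₂ = λ i₁ i₂ j₁ j₂ bi bj _ (i<j , _ , j′<i′) → ℕₚ.<⇒≱ i<j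
        (greedy bj bi j′<i′ (ℕₚ.≤-<-trans (region-mono (ℕₚ.<⇒≤ i<j)) (bump-ascending {P} nn₁ bj)))
    }
    where
    nn₁ : SeparatesRegions J P
    nn₁ = separated⇒separates {P} sep

  NC-encoding : IsEncoding (NC J) Ballot (NC-code.partitionCode ∘ proj₁)
  NC-encoding = NC-code.greedy-encoding (IsNoncrossing J) noncrossing⇒greedy greedy⇒noncrossing

  NN-encoding : IsEncoding (NN J) Ballot (NN-code.partitionCode ∘ proj₁)
  NN-encoding = NN-code.greedy-encoding (IsNonnesting J) nonnesting⇒greedy greedy⇒nonnesting

  -- Codes of the avoiding permutations

  -- No cut separates two positions of one region, so all reflections between them lie in `J` and
  -- their ascents chain together.
  quotient⇒increasing : ∀ {w} → InParabolicQuotient J w → IncreasingInRegions w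
  quotient⇒increasing {w} quotient {i} {j} eq i<j = go j (<-wellFounded (toℕ j)) eq i<j
    where
    go : ∀ j → Acc ℕ._<_ (toℕ j) → region i ≡ region j → i Fin.< j → value w i ℕ.< value w j
    go (suc k) (acc rec) eq i<1+k = below (i Finₚ.≟ inject₁ k)
      where
      i≤k : i Fin.≤ inject₁ k
      i≤k = subst (toℕ i ℕ.≤_) (sym (Finₚ.toℕ-inject₁ k)) (ℕₚ.≤-pred i<1+k)
      k<1+k : inject₁ k Fin.< suc k
      k<1+k = ℕₚ.≤-reflexive (cong suc (Finₚ.toℕ-inject₁ k))
      k∈J : k ∈ J
      k∈J = decidable-stable (k ∈? J) λ k∉J →
        ℕₚ.<-irrefl eq (region-mono-< k k∉J (ℕₚ.≤-pred i<1+k) ℕₚ.≤-refl)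
      eq′ : region i ≡ region (inject₁ k)
      eq′ = ℕₚ.≤-antisym (region-mono i≤k)
              (ℕₚ.≤-trans (region-mono (ℕₚ.<⇒≤ k<1+k)) (ℕₚ.≤-reflexive (sym eq)))
      below : Dec (i ≡ inject₁ k) → value w i ℕ.< value w (suc k)
      below (yes refl) = quotient k k∈J
      below (no i≢k)   = ℕₚ.<-trans (go (inject₁ k) (rec k<1+k) eq′ (Finₚ.≤∧≢⇒< i≤k i≢k)) (quotient k k∈J)

  increasing⇒quotient : ∀ {w} → IncreasingInRegions w → InParabolicQuotient J w
  increasing⇒quotient inc k k∈J = inc (sameRegion⇒≡ same) k<1+k
    where
    k<1+k : inject₁ k Fin.< suc k
    k<1+k = ℕₚ.≤-reflexive (cong suc (Finₚ.toℕ-inject₁ k))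
    same : SameRegion J (inject₁ k) (suc k)
    same l l∉J = mk⇔
      (λ k≤l → ℕₚ.≤∧≢⇒< (subst (ℕ._≤ toℕ l) (Finₚ.toℕ-inject₁ k) k≤l)
        (λ e → l∉J (subst (_∈ J) (Finₚ.toℕ-injective e) k∈J)))
      (λ k<l → ℕₚ.≤-trans (ℕₚ.<⇒≤ k<1+k) k<l)

  avoids231⇒avoiding : ∀ {w} → Avoids231 J w → Avoiding w
  avoids231⇒avoiding {w} avoids {i} {j} {k} (i<k , eq) i<j j<k = ℕₚ.≤∧≢⇒<
    (ℕₚ.≮⇒≥ λ wi<wj → avoids i j k
      ( reg<⇒< i<j , reg<⇒< j<k , <⇒¬sameRegion i<j , <⇒¬sameRegion j<k
      , <⇒¬sameRegion (ℕₚ.<-trans i<j j<k) , ℕₚ.≤-reflexive (sym eq) , wi<wj , eq))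
    (λ e → Finₚ.<⇒≢ (reg<⇒< i<j) (sym (value-injective w e)))

  avoiding⇒avoids231 : ∀ {w} → Avoiding w → Avoids231 J w
  avoiding⇒avoids231 avoid i j k (i<j , j<k , i≁j , j≁k , _ , _ , wi<wj , eq) =
    ℕₚ.<-asym wi<wj (avoid (ℕₚ.<-trans i<j j<k , eq) (region-< i<j i≁j) (region-< j<k j≁k))

  wordCode : Permutation′ (suc m) → Code (suc m)
  wordCode w = openers (inverseDescent? w) , closers (inverseDescent? w)

  -- Values increase inside a region, so an inverse descent has to join different regions.
  word-matching : ∀ {w} → IncreasingInRegions w →
    IsMatching (openers (inverseDescent? w)) (closers (inverseDescent? w)) (InverseDescent w)
  word-matching {w} inc = openers×closers-matching (inverseDescent? w)
    (inverseDescent-right-unique w) (inverseDescent-left-unique w)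
    λ (i<k , eq) → ℕₚ.≤∧≢⇒< (region-mono (ℕₚ.<⇒≤ i<k))
      (λ e → ℕₚ.<-asym (inc e i<k) (ℕₚ.≤-reflexive (sym eq)))

  private
    Word : Set
    Word = Setoid.Carrier (𝔖231 J)

  descent-transport : (w w′ : Permutation′ (suc m)) → (∀ x → w ⟨$⟩ʳ x ≡ w′ ⟨$⟩ʳ x) → ∀ {i k} → InverseDescent w i k → InverseDescent w′ i k
  descent-transport w w′ w≈w′ {i} {k} (i<k , eq) =
    i<k , trans (cong toℕ (sym (w≈w′ i))) (trans eq (cong (suc ∘ toℕ) (w≈w′ k)))

  wordCode-cong : (w w′ : Word) → (∀ x → proj₁ w ⟨$⟩ʳ x ≡ proj₁ w′ ⟨$⟩ʳ x) → wordCode (proj₁ w) ≡ wordCode (proj₁ w′)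
  wordCode-cong (w , _) (w′ , q′ , _) w≈w′ = matching-code (inverseDescent? w)
    (matching-map (word-matching {w′} (quotient⇒increasing {w′} q′))
      (descent-transport w w′ w≈w′) (descent-transport w′ w (λ x → sym (w≈w′ x))))

  wordCode-injective : (w w′ : Word) → wordCode (proj₁ w) ≡ wordCode (proj₁ w′) →
    ∀ x → proj₁ w ⟨$⟩ʳ x ≡ proj₁ w′ ⟨$⟩ʳ x
  wordCode-injective (w , q , a) (w′ , q′ , a′) eq =
    words-equal {w = w} {w′} inc (avoids231⇒avoiding {w} a) (word-matching {w} inc)
      inc′ (avoids231⇒avoiding {w′} a′)
      (subst (λ c → IsMatching (proj₁ c) (proj₂ c) (InverseDescent w′)) (sym eq) (word-matching {w′} inc′))
    where
    inc : IncreasingInRegions w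
    inc  = quotient⇒increasing {w} q
    inc′ : IncreasingInRegions w′
    inc′ = quotient⇒increasing {w′} q′

  wordCode-ballot : (w : Word) → Ballot (wordCode (proj₁ w))
  wordCode-ballot (w , q , _) = matching⇒ballot (word-matching {w} (quotient⇒increasing {w} q))

  wordCode-surjective : ∀ c → Ballot c → ∃ λ (w : Word) → wordCode (proj₁ w) ≡ c
  wordCode-surjective (O , C) ballot = pack (Reading.Progress.word-exists region region-mono O C ballot)
    where
    pack : (∃ λ w → IncreasingInRegions w × Avoiding w × IsMatching O C (InverseDescent w)) →
           ∃ λ (w : Word) → wordCode (proj₁ w) ≡ (O , C)
    pack (w , inc , avoid , M) =
      (w , increasing⇒quotient {w} inc , avoiding⇒avoids231 {w} avoid) , matching-code (inverseDescent? w) M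

  𝔖231-encoding : IsEncoding (𝔖231 J) Ballot (wordCode ∘ proj₁)
  𝔖231-encoding = record
    { congruent  = λ {w} {w′} → wordCode-cong w w′
    ; injective  = λ {w} {w′} → wordCode-injective w w′
    ; valid      = wordCode-ballot
    ; surjective = wordCode-surjective
    }

-- Bijections through the common list of ballot pairs

equinumerous⇒bijection : ∀ {a b ℓ₁ ℓ₂} {S : Setoid a ℓ₁} {T : Setoid b ℓ₂} {k} →
  HasCardinality S k → HasCardinality T k → Bijection S T
equinumerous⇒bijection f g = f ⤖-∘ bijection-≡ g

theorem1p2 : (m : ℕ) (J : Subset m) →
    Bijection (𝔖231 J) (NC J) × Bijection (NC J) (NN J) ×
    (∃ λ k → HasCardinality (𝔖231 J) k × HasCardinality (NC J) k × HasCardinality (NN J) k)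
theorem1p2 m J =
  equinumerous⇒bijection words noncrossing , equinumerous⇒bijection noncrossing nonnesting ,
  (_ , words , noncrossing , nonnesting)
  where
  open Regions J
  open Matchings region region-mono using (ballot?)
  words       = encoding⇒cardinality ballot? 𝔖231-encoding
  noncrossing = encoding⇒cardinality ballot? NC-encoding
  nonnesting  = encoding⇒cardinality ballot? NN-encoding
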